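{- Let $n\ge 2$, $k\ge 1$, $t\ge 1$ be integers and let $D$ be a target distribution on $P_n^{(k)}$ of size $t$. Then $\pi(P_n^{(k)},D)\le p_t(n,k)-s(D)+1$.
   Context: For positive integers $n,k$, $P_n^{(k)}$ is the graph with vertices $v_1,\dots,v_n$ in which $v_i\sim v_j$ iff $1\le |i-j|\le k$. For $n\ge 2$ put $d=\lfloor (n-2)/k\rfloor+1$ (the diameter of $P_n^{(k)}$), $b=(n-2)-k(d-1)$ (so $0\le b<k$), $l_t(n,k)=t2^d+b$, $w_t(n)=2t+n-2$, and $p_t(n,k)=\max\{l_t(n,k),w_t(n)\}$. A configuration is a function $C:V\to\mathbb{N}$ of size $|C|=\sum_v C(v)$; a pebbling step from a vertex $u$ with at least two pebbles to a neighbor $w$ removes two pebbles from $u$ and adds one to $w$. A target distribution is $D:V\to\mathbb{N}$ with size $|D|=\sum_vD(v)$; $C$ is $D$-solvable if some sequence of pebbling steps results in at least $D(v)$ pebbles on every vertex $v$ simultaneously; $\pi(G,D)$ is the least $m$ such that every configuration of size at least $m$ on $G$ is $D$-solvable. $s(D)=|\{v: D(v)>0\}|$. -}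

module Defs where

open import Data.Nat using (ℕ; zero; suc; _+_; _*_; _∸_; _^_; _≤_; _<_; NonZero; ∣_-_∣; _/_; _⊔_)
open import Data.Nat.DivMod
open import Data.Fin using (Fin; toℕ; _≟_)
open import Data.List using (List; map; allFin)
open import Data.Nat.ListAction using (sum)
open import Data.Product using (Σ; ∃; _×_; _,_)
open import Relation.Nullary using (yes; no)
open import Relation.Binary.PropositionalEquality using (_≡_)
open import Relation.Binary.Construct.Closure.ReflexiveTransitive using (Star)

-- Vertices of P_n^(k) are Fin n (v_{i+1} ↔ i).
-- Adjacency in P_n^(k): 1 ≤ |i - j| ≤ k.
Adj : (n k : ℕ) → Fin n → Fin n → Set
Adj n k i j = (1 ≤ ∣ toℕ i - toℕ j ∣) × (∣ toℕ i - toℕ j ∣ ≤ k)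

Config : ℕ → Set
Config n = Fin n → ℕ

size : ∀ {n} → Config n → ℕ
size {n} C = sum (map C (allFin n))

support : ∀ {n} → Config n → ℕ
support {n} D = sum (map (λ v → ind (D v)) (allFin n))
  where
  ind : ℕ → ℕ
  ind zero    = 0
  ind (suc _) = 1

move : ∀ {n} → Config n → Fin n → Fin n → Config n
move C u w v with v ≟ u | v ≟ w
... | yes _ | _     = C v ∸ 2
... | no _  | yes _ = suc (C v)
... | no _  | no _  = C v

data Step (n k : ℕ) (C : Config n) : Config n → Set where
  step : (u w : Fin n) → Adj n k u w → 2 ≤ C u → Step n k C (move C u w)

Solvable : (n k : ℕ) → Config n → Config n → Set
Solvable n k D C =
  Σ (Config n) λ C' → Star (Step n k) C C' × (∀ v → D v ≤ C' v)

diam : (n k : ℕ) → .{{NonZero k}} → ℕ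
diam n k = (n ∸ 2) / k + 1

bpar : (n k : ℕ) → .{{NonZero k}} → ℕ
bpar n k = (n ∸ 2) ∸ k * (diam n k ∸ 1)

lt : (t n k : ℕ) → .{{NonZero k}} → ℕ
lt t n k = t * 2 ^ diam n k + bpar n k

wt : (t n : ℕ) → ℕ
wt t n = 2 * t + n ∸ 2

pt : (t n k : ℕ) → .{{NonZero k}} → ℕ
pt t n k = lt t n k ⊔ wt t n

{-# OPTIONS --safe #-}
module Submission where

open import Defs
open import Data.Nat using (ℕ; zero; suc; _+_; _*_; _∸_; _^_; _≤_; _<_; _⊔_; _⊓_; z≤n; s≤s; s≤s⁻¹; NonZero; >-nonZero⁻¹; ∣_-_∣; _/_; _%_; _≤?_; _<?_; _≟_)
open import Data.Nat.DivMod
open import Data.Nat.ListAction using (sum)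
open import Data.Nat.Properties
open import Data.Nat.Tactic.RingSolver using (solve-∀)
open import Data.Fin using (Fin; zero; suc; toℕ; fromℕ<)
import Data.Fin as Fin
open import Data.Fin.Properties using (toℕ-fromℕ<; toℕ-injective; toℕ<n)
open import Data.List using (map; allFin; tabulate)
open import Data.List.Properties using (map-tabulate; map-cong)
open import Data.Product using (∃; _×_; _,_; proj₁; proj₂)
open import Data.Sum using (_⊎_; inj₁; inj₂; [_,_]′)
open import Function using (_∘_)
open import Relation.Nullary using (¬_; Dec; yes; no; contradiction)
open import Relation.Nullary.Decidable using (_⊎-dec_)
open import Relation.Binary.Construct.Closure.ReflexiveTransitive using (Star; ε; _◅_; _◅◅_)
open import Relation.Binary.PropositionalEquality using (_≡_; _≢_; refl; sym; trans; cong; cong₂; subst; module ≡-Reasoning)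

-- Induction on n + |C| for p_t(n) < |C| + s(D). Pebbles lying on demanded vertices are
-- matched first, so C and D have disjoint supports. If n ≤ k + 1 the graph is complete and
-- counting pairs of pebbles suffices. If an end vertex is demanded and has a pebbled
-- neighbour a, that pebble replaces one unit of demand at the end by one unit at a: |C|
-- drops by one and s(D) grows by one, or else the end vertex becomes free and is deleted.
-- If the end is demanded and the first k vertices are empty, double their demand k steps
-- further on and delete them; this costs nothing since p_{2t}(n-k) ≤ p_t(n). (For
-- n ≤ 2k + 1 only the first n - k - 1 vertices are treated so, and pairs are counted in the
-- complete graph on the last k + 1 vertices.) Finally, if no end is demanded, cut the
-- path at a vertex y whose demand is shared between both sides:
-- since p_a(y) + p_{a'}(n-y+1) ≤ p_{a+a'-1}(n) + 1, the two sides of a cut cannot both have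
-- too few pebbles, and at the first place where the left side fails both sides succeed.

-- Finite sums over initial segments of ℕ

∑ : ℕ → (ℕ → ℕ) → ℕ
∑ zero    f = 0
∑ (suc n) f = f 0 + ∑ n (f ∘ suc)

∑-mono : ∀ n {f g} → (∀ i → i < n → f i ≤ g i) → ∑ n f ≤ ∑ n g
∑-mono zero    h = z≤n
∑-mono (suc n) h = +-mono-≤ (h 0 (s≤s z≤n)) (∑-mono n λ i i<n → h (suc i) (s≤s i<n))

∑-cong : ∀ n {f g} → (∀ i → i < n → f i ≡ g i) → ∑ n f ≡ ∑ n g
∑-cong n h = ≤-antisym (∑-mono n λ i i<n → ≤-reflexive (h i i<n))
                       (∑-mono n λ i i<n → ≤-reflexive (sym (h i i<n)))

∑-+ : ∀ n f g → ∑ n (λ i → f i + g i) ≡ ∑ n f + ∑ n g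
∑-+ zero    f g = refl
∑-+ (suc n) f g rewrite ∑-+ n (f ∘ suc) (g ∘ suc) = lem (f 0) (g 0) _ _
  where
  lem : ∀ a b c d → a + b + (c + d) ≡ a + c + (b + d)
  lem = solve-∀

∑-* : ∀ n c f → ∑ n (λ i → c * f i) ≡ c * ∑ n f
∑-* zero    c f = sym (*-zeroʳ c)
∑-* (suc n) c f rewrite ∑-* n c (f ∘ suc) = sym (*-distribˡ-+ c (f 0) _)

∑-zero : ∀ n {f} → (∀ i → i < n → f i ≡ 0) → ∑ n f ≡ 0
∑-zero n {f} h = trans (∑-cong n h) (∑-* n 0 f)

∑-≡0 : ∀ n {f} → ∑ n f ≡ 0 → ∀ i → i < n → f i ≡ 0
∑-≡0 (suc n) {f} h zero    _         = m+n≡0⇒m≡0 (f 0) h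
∑-≡0 (suc n) {f} h (suc i) (s≤s i<n) = ∑-≡0 n (m+n≡0⇒n≡0 (f 0) h) i i<n

∑-split : ∀ m r f → ∑ (m + r) f ≡ ∑ m f + ∑ r (λ i → f (m + i))
∑-split zero    r f = refl
∑-split (suc m) r f rewrite ∑-split m r (f ∘ suc) = sym (+-assoc (f 0) _ _)

∑-snoc : ∀ n f → ∑ (n + 1) f ≡ ∑ n f + f n
∑-snoc n f rewrite ∑-split n 1 f | +-identityʳ n | +-identityʳ (f n) = refl

∑-reverse : ∀ n f → ∑ n (λ i → f (n ∸ suc i)) ≡ ∑ n f
∑-reverse zero    f = refl
∑-reverse (suc n) f = begin
  f n + ∑ n (λ i → f (n ∸ suc i)) ≡⟨ cong (f n +_) (∑-reverse n f) ⟩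
  f n + ∑ n f                     ≡⟨ +-comm (f n) _ ⟩
  ∑ n f + f n                     ≡⟨ ∑-snoc n f ⟨
  ∑ (n + 1) f                     ≡⟨ cong (λ m → ∑ m f) (+-comm n 1) ⟩
  ∑ (suc n) f                     ∎
  where open ≡-Reasoning

∑-<⇒∃ : ∀ n {f g} → ∑ n f < ∑ n g → ∃ λ i → i < n × f i < g i
∑-<⇒∃ zero    ()
∑-<⇒∃ (suc n) {f} {g} h with f 0 <? g 0
... | yes f<g = 0 , s≤s z≤n , f<g
... | no  f≮g with ∑-<⇒∃ n (+-cancelˡ-< (f 0) _ _ (<-≤-trans h (+-monoˡ-≤ _ (≮⇒≥ f≮g))))
...   | i , i<n , lt = suc i , s≤s i<n , lt

∑-1 : ∀ n → ∑ n (λ _ → 1) ≡ n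
∑-1 zero    = refl
∑-1 (suc n) = cong suc (∑-1 n)

δ : ℕ → ℕ → ℕ
δ zero    zero    = 1
δ zero    (suc j) = 0
δ (suc i) zero    = 0
δ (suc i) (suc j) = δ i j

δ-refl : ∀ i → δ i i ≡ 1
δ-refl zero    = refl
δ-refl (suc i) = δ-refl i

δ-≢ : ∀ {i j} → i ≢ j → δ i j ≡ 0
δ-≢ {zero}  {zero}  ne = contradiction refl ne
δ-≢ {zero}  {suc j} ne = refl
δ-≢ {suc i} {zero}  ne = refl
δ-≢ {suc i} {suc j} ne = δ-≢ {i} {j} (ne ∘ cong suc)

δ-sym : ∀ i j → δ i j ≡ δ j i
δ-sym zero    zero    = refl
δ-sym zero    (suc j) = refl
δ-sym (suc i) zero    = refl
δ-sym (suc i) (suc j) = δ-sym i j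

∑-δ : ∀ n {a} (g : ℕ → ℕ) → a < n → ∑ n (λ i → δ a i * g i) ≡ g a
∑-δ (suc n) {zero}  g _         rewrite ∑-* n 0 (g ∘ suc) = trans (+-identityʳ _) (+-identityʳ _)
∑-δ (suc n) {suc a} g (s≤s a<n) = ∑-δ n (g ∘ suc) a<n

∑-δ-1 : ∀ n {a} → a < n → ∑ n (δ a) ≡ 1
∑-δ-1 n {a} a<n = trans (∑-cong n λ i _ → sym (*-identityʳ _)) (∑-δ n (λ _ → 1) a<n)

infix 5 _δ≤_

_δ≤_ : ∀ {c a} (f : ℕ → ℕ) → c ≤ f a → ∀ i → c * δ a i ≤ f i
_δ≤_ {c} {a} f c≤ i with a ≟ i
... | yes refl rewrite δ-refl a | *-identityʳ c = c≤
... | no  a≢i  rewrite δ-≢ a≢i | *-zeroʳ c      = z≤n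

cat : ℕ → (ℕ → ℕ) → (ℕ → ℕ) → ℕ → ℕ
cat zero    f g i       = g i
cat (suc m) f g zero    = f 0
cat (suc m) f g (suc i) = cat m (f ∘ suc) g i

-- The weight `h` sees the index as well as the value, so that one identity serves plain sums,
-- indicator sums and loads.
∑-cat : ∀ m r f g (h : ℕ → ℕ → ℕ) →
  ∑ (m + r) (λ i → h (cat m f g i) i) ≡ ∑ m (λ i → h (f i) i) + ∑ r (λ i → h (g i) (m + i))
∑-cat zero    r f g h = refl
∑-cat (suc m) r f g h rewrite ∑-cat m r (f ∘ suc) g (λ c i → h c (suc i)) = sym (+-assoc (h (f 0) 0) _ _)

-- This repeats the summand of `support`, which is local there; `support-ind` identifies the two.
ind : ℕ → ℕ
ind zero    = 0
ind (suc _) = 1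

ind≤1 : ∀ a → ind a ≤ 1
ind≤1 zero    = z≤n
ind≤1 (suc a) = ≤-refl

ind≤ : ∀ a → ind a ≤ a
ind≤ zero    = z≤n
ind≤ (suc a) = s≤s z≤n

ind-mono : ∀ {a b} → a ≤ b → ind a ≤ ind b
ind-mono z≤n     = z≤n
ind-mono (s≤s _) = ≤-refl

1≤ind : ∀ {a} → 1 ≤ a → 1 ≤ ind a
1≤ind (s≤s _) = ≤-refl

-- Solvability as an additive preorder on configurations.

module Conversion (N k : ℕ) where

  infix 4 _⟹_ _≼_
  infixl 6 _⊕_
  infixl 7 _·_

  _≼_ : Config N → Config N → Set
  C ≼ D = ∀ v → C v ≤ D v

  _⊕_ : Config N → Config N → Config N
  (C ⊕ D) v = C v + D v

  _·_ : ℕ → Config N → Config N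
  (c · C) v = c * C v

  -- The arguments are swapped so that resources stand on the left. Only lower bounds on the final
  -- pebbles are demanded, so surplus can be discarded and conversions compose and add up.
  _⟹_ : Config N → Config N → Set
  C ⟹ D = Solvable N k D C

  move-mono : ∀ {C E} u w → C ≼ E → move C u w ≼ move E u w
  move-mono u w C≼E v with v Fin.≟ u | v Fin.≟ w
  ... | yes _ | _     = ∸-monoˡ-≤ 2 (C≼E v)
  ... | no _  | yes _ = s≤s (C≼E v)
  ... | no _  | no _  = C≼E v

  move-⊕ : ∀ C F u w → 2 ≤ C u → move C u w ⊕ F ≼ move (C ⊕ F) u w
  move-⊕ C F u w 2≤ v with v Fin.≟ u | v Fin.≟ w
  ... | yes refl | _     = ≤-reflexive (sym (+-∸-comm (F v) 2≤))
  ... | no _     | yes _ = ≤-refl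
  ... | no _     | no _  = ≤-refl

  steps-mono : ∀ {C C' E} → C ≼ E → Star (Step N k) C C' → E ⟹ C'
  steps-mono C≼E ε = _ , ε , C≼E
  steps-mono C≼E (step u w adj 2≤ ◅ ss) with steps-mono (move-mono u w C≼E) ss
  ... | E' , ss' , C'≼E' = E' , step u w adj (≤-trans 2≤ (C≼E u)) ◅ ss' , C'≼E'

  ≼⇒⟹ : ∀ {C D} → D ≼ C → C ⟹ D
  ≼⇒⟹ D≼C = _ , ε , D≼C

  ⟹-trans : ∀ {C D E} → C ⟹ D → D ⟹ E → C ⟹ E
  ⟹-trans (C' , ss , D≼C') (D' , ss' , E≼D') with steps-mono D≼C' ss'
  ... | C'' , ss'' , D'≼C'' = C'' , ss ◅◅ ss'' , λ v → ≤-trans (E≼D' v) (D'≼C'' v)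

  steps-⊕ : ∀ {C C'} F → Star (Step N k) C C' → C ⊕ F ⟹ C' ⊕ F
  steps-⊕ F ε = ≼⇒⟹ λ v → ≤-refl
  steps-⊕ {C} F (step u w adj 2≤ ◅ ss) =
    ⟹-trans (_ , step u w adj (≤-trans 2≤ (m≤m+n _ _)) ◅ ε , move-⊕ C F u w 2≤) (steps-⊕ F ss)

  ⟹-⊕ˡ : ∀ {C D} F → C ⟹ D → C ⊕ F ⟹ D ⊕ F
  ⟹-⊕ˡ F (C' , ss , D≼C') = ⟹-trans (steps-⊕ F ss) (≼⇒⟹ λ v → +-monoˡ-≤ _ (D≼C' v))

  ⟹-⊕ : ∀ {C D C' D'} → C ⟹ D → C' ⟹ D' → C ⊕ C' ⟹ D ⊕ D'
  ⟹-⊕ {C} {D} {C'} {D'} p q = ⟹-trans (⟹-⊕ˡ C' p)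
    (⟹-trans (≼⇒⟹ λ v → ≤-reflexive (+-comm (C' v) (D v)))
    (⟹-trans (⟹-⊕ˡ D q) (≼⇒⟹ λ v → ≤-reflexive (+-comm (D v) (D' v)))))

  ⟹-· : ∀ {C D} c → C ⟹ D → c · C ⟹ c · D
  ⟹-· zero    p = ≼⇒⟹ λ v → z≤n
  ⟹-· (suc c) p = ⟹-⊕ p (⟹-· c p)

  -- Position `i` of an abstract path is worth the configuration `x i`. Subpaths and reversals are
  -- obtained by reindexing `x`, while all pebbling takes place in one ambient graph.
  load : ℕ → (ℕ → Config N) → (ℕ → ℕ) → Config N
  load n x C v = ∑ n (λ i → C i * x i v)

  load-+ : ∀ n x C D v → load n x (λ i → C i + D i) v ≡ load n x C v + load n x D v
  load-+ n x C D v = trans (∑-cong n λ i _ → *-distribʳ-+ (x i v) (C i) (D i)) (∑-+ n _ _)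

  load-* : ∀ n x c C v → load n x (λ i → c * C i) v ≡ c * load n x C v
  load-* n x c C v = trans (∑-cong n λ i _ → *-assoc c (C i) (x i v)) (∑-* n c _)

  load-δ : ∀ n x {a} v → a < n → load n x (δ a) v ≡ x a v
  load-δ n x v a<n = ∑-δ n (λ i → x i v) a<n

  load-split : ∀ m r x C v → load (m + r) x C v ≡ load m x C v + load r (x ∘ (m +_)) (C ∘ (m +_)) v
  load-split m r x C v = ∑-split m r _

  load-cat : ∀ m r x f g v → load (m + r) x (cat m f g) v ≡ load m x f v + load r (x ∘ (m +_)) g v
  load-cat m r x f g v = ∑-cat m r f g (λ c i → c * x i v)

  load-zero : ∀ n x {C} → ∑ n C ≡ 0 → ∀ v → load n x C v ≡ 0
  load-zero n x h v = ∑-zero n λ i i<n → cong (_* x i v) (∑-≡0 n h i i<n)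

  load-⟹ : ∀ n {x y} C → (∀ i → i < n → 2 · x i ⟹ y i) → 2 · load n x C ⟹ load n y C
  load-⟹ zero    C h = ≼⇒⟹ λ v → z≤n
  load-⟹ (suc n) {x} {y} C h =
    ⟹-trans (≼⇒⟹ λ v → ≤-reflexive (lem (C 0) (x 0 v) (load n (x ∘ suc) (C ∘ suc) v)))
      (⟹-⊕ (⟹-· (C 0) (h 0 (s≤s z≤n))) (load-⟹ n (C ∘ suc) λ i i<n → h (suc i) (s≤s i<n)))
    where
    lem : ∀ c a l → c * (2 * a) + 2 * l ≡ 2 * (c * a + l)
    lem = solve-∀

  -- The part `C i ⊓ D i` is set aside and returned at the end, so only surplus has to be converted
  -- into deficit. The extra output `F` lets demand outside these positions be served at the same
  -- time.
  match-⊕ : ∀ n x C D F → load n x (λ i → C i ∸ D i) ⟹ load n x (λ i → D i ∸ C i) ⊕ F → load n x C ⟹ load n x D ⊕ F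
  match-⊕ n x C D F p =
    ⟹-trans (≼⇒⟹ λ v → ≤-reflexive (split C D v))
    (⟹-trans (⟹-⊕ˡ (load n x λ i → C i ⊓ D i) p)
    (≼⇒⟹ λ v → ≤-reflexive (begin
      load n x D v + F v
        ≡⟨ cong (_+ F v) (split D C v) ⟨
      load n x (λ i → D i ∸ C i) v + load n x (λ i → D i ⊓ C i) v + F v
        ≡⟨ cong (λ m → load n x (λ i → D i ∸ C i) v + m + F v) (∑-cong n λ i _ → cong (_* x i v) (⊓-comm (D i) (C i))) ⟩
      load n x (λ i → D i ∸ C i) v + load n x (λ i → C i ⊓ D i) v + F v
        ≡⟨ lem (load n x (λ i → D i ∸ C i) v) _ (F v) ⟩
      load n x (λ i → D i ∸ C i) v + F v + load n x (λ i → C i ⊓ D i) v ∎)))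
    where
    open ≡-Reasoning
    lem : ∀ a b c → a + b + c ≡ a + c + b
    lem = solve-∀
    split : ∀ C D v → load n x (λ i → C i ∸ D i) v + load n x (λ i → C i ⊓ D i) v ≡ load n x C v
    split C D v = trans (sym (load-+ n x (λ i → C i ∸ D i) (λ i → C i ⊓ D i) v)) (∑-cong n λ i _ → cong (_* x i v)
      (trans (+-comm (C i ∸ D i) _) (trans (cong (_+ (C i ∸ D i)) (⊓-comm (C i) (D i))) (m⊓n+n∸m≡n (D i) (C i)))))

  match : ∀ n x C D → load n x (λ i → C i ∸ D i) ⟹ load n x (λ i → D i ∸ C i) → load n x C ⟹ load n x D
  match n x C D p = ⟹-trans
    (match-⊕ n x C D (λ _ → 0) (⟹-trans p (≼⇒⟹ λ v → ≤-reflexive (+-identityʳ _))))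
    (≼⇒⟹ λ v → m≤m+n _ 0)

-- The hypothesis says h - g = (b - a) + z, with no subtraction so that it is a semiring identity.
linear : ∀ {a b g h} z → a ≤ b → g + b + z ≡ h + a → g ≤ h
linear {a} {b} {g} {h} z a≤b eq = +-cancelʳ-≤ b g h (begin
  g + b     ≤⟨ m≤m+n _ z ⟩
  g + b + z ≡⟨ eq ⟩
  h + a     ≤⟨ +-monoʳ-≤ h a≤b ⟩
  h + b     ∎)
  where open ≤-Reasoning

1+e≤2^e : ∀ e → suc e ≤ 2 ^ e
1+e≤2^e zero    = ≤-refl
1+e≤2^e (suc e) = linear e (+-mono-≤ (1+e≤2^e e) (1+e≤2^e e)) (lem e (2 ^ e))
  where
  lem : ∀ e p → suc (suc e) + (p + p) + e ≡ 2 * p + (suc e + suc e)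
  lem = solve-∀

-- Arithmetic of the bound p_t(n).

module Bound (k : ℕ) where

  -- For k ≥ 1 this is p_t(2 + k*e), where the diameter is e + 1 and the remainder b is zero.
  M : ℕ → ℕ → ℕ
  M t e = t * 2 ^ suc e ⊔ (2 * t + k * e)

  l≤M : ∀ t e → t * 2 ^ suc e ≤ M t e
  l≤M t e = m≤m⊔n _ _

  w≤M : ∀ t e → 2 * t + k * e ≤ M t e
  w≤M t e = m≤n⊔m _ _

  M+-lub : ∀ t e c {x} → t * 2 ^ suc e + c ≤ x → 2 * t + k * e + c ≤ x → M t e + c ≤ x
  M+-lub t e c l≤ w≤ =
    ≤-trans (≤-reflexive (+-distribʳ-⊔ c (t * 2 ^ suc e) (2 * t + k * e))) (⊔-lub l≤ w≤)

  -- The left side is convex in j for fixed j + m, and M t (j + m) dominates it at both ends.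
  M-convex : ∀ t j m → t * 2 ^ suc j + k * m ≤ M t (j + m)
  M-convex t j m with k ≤? t * 2 ^ suc j
  ... | yes k≤ = ≤-trans (begin
    t * 2 ^ suc j + k * m                     ≤⟨ +-monoʳ-≤ _ (*-monoˡ-≤ m k≤) ⟩
    t * 2 ^ suc j + t * 2 ^ suc j * m         ≡⟨ *-suc (t * 2 ^ suc j) m ⟨
    t * 2 ^ suc j * suc m                     ≤⟨ *-monoʳ-≤ (t * 2 ^ suc j) (1+e≤2^e m) ⟩
    t * 2 ^ suc j * 2 ^ m                     ≡⟨ *-assoc t _ _ ⟩
    t * (2 ^ suc j * 2 ^ m)                   ≡⟨ cong (t *_) (^-distribˡ-+-* 2 (suc j) m) ⟨
    t * 2 ^ suc (j + m)                       ∎) (l≤M t (j + m))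
    where open ≤-Reasoning
  ... | no k≰ = ≤-trans (below j (<⇒≤ (≰⇒> k≰))) (w≤M t (j + m))
    where
    open ≤-Reasoning
    lem : ∀ t m → t * 2 + k * m ≡ 2 * t + k * m
    lem t m = cong (_+ k * m) (*-comm t 2)
    below : ∀ j → t * 2 ^ suc j ≤ k → t * 2 ^ suc j + k * m ≤ 2 * t + k * (j + m)
    below zero    _  = ≤-reflexive (lem t m)
    below (suc j) le = begin
      t * 2 ^ suc (suc j) + k * m  ≤⟨ +-monoˡ-≤ (k * m) le ⟩
      k + k * m                    ≤⟨ +-monoʳ-≤ k (*-monoʳ-≤ k (m≤n+m m j)) ⟩
      k + k * (j + m)              ≡⟨ *-suc k (j + m) ⟨
      k * (suc j + m)              ≤⟨ m≤n+m _ (2 * t) ⟩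
      2 * t + k * (suc j + m)      ∎

  M-extend : ∀ t e j → M t e + k * j ≤ M t (e + j)
  M-extend t e j = M+-lub t e (k * j) (M-convex t e j)
    (≤-trans (≤-reflexive (trans (+-assoc (2 * t) _ _) (cong (2 * t +_) (sym (*-distribˡ-+ k e j))))) (w≤M t (e + j)))

  -- The exponential terms agree. The linear term 4t + k*e is the value that `M-convex` bounds at
  -- `j = 1`.
  M-double : ∀ t e → M (2 * t) e ≤ M t (suc e)
  M-double t e = ⊔-lub
    (≤-trans (≤-reflexive (lem t (2 ^ suc e))) (l≤M t (suc e)))
    (≤-trans (≤-reflexive (lem' t (k * e))) (M-convex t 1 e))
    where
    lem : ∀ t p → 2 * t * p ≡ t * (2 * p)
    lem = solve-∀
    lem' : ∀ t q → 2 * (2 * t) + q ≡ t * 4 + q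
    lem' = solve-∀

  M-suc : ∀ t e → M t e + 2 ≤ M (suc t) e
  M-suc t e = M+-lub t e 2
    (≤-trans (≤-trans (≤-reflexive (+-comm _ 2)) (+-monoˡ-≤ (t * 2 ^ suc e) (*-monoʳ-≤ 2 (≤-trans (s≤s z≤n) (1+e≤2^e e)))))
        (l≤M (suc t) e))
    (≤-trans (≤-reflexive (lem t (k * e))) (w≤M (suc t) e))
    where
    lem : ∀ t q → 2 * t + q + 2 ≡ 2 * suc t + q
    lem = solve-∀

  -- The demands α+1 and β+1 share one vertex, so that together they amount to 1+α+β.
  M-superadd : ∀ α β e e' → M (suc α) e + M (suc β) e' ≤ M (suc (α + β)) (e + e') + 2
  M-superadd α β e e' = M+-lub (suc α) e (M (suc β) e')
    (≤-trans (≤-reflexive (+-comm (suc α * 2 ^ suc e) _)) (M+-lub (suc β) e' _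
      (≤-trans (≤-reflexive (+-comm (suc β * 2 ^ suc e') _)) ll)
      (≤-trans (≤-reflexive (+-comm (2 * suc β + k * e') _)) lw)))
    (≤-trans (≤-reflexive (+-comm (2 * suc α + k * e) _)) (M+-lub (suc β) e' _
      (≤-trans (≤-reflexive (+-comm (suc β * 2 ^ suc e') _)) wl)
      (≤-trans (≤-reflexive (+-comm (2 * suc β + k * e') _)) ww)))
    where
    t = suc (α + β)
    -- With each power of two written as a successor, the slack in `mixed` and `ll` is a polynomial
    -- with natural coefficients, which `linear` takes as `z`.
    pos : ∀ e → ∃ λ x → 2 ^ e ≡ suc x
    pos e with 2 ^ e | 1+e≤2^e e
    ... | suc x | _ = x , refl
    mixed : ∀ α β e e' → suc α * 2 ^ suc e + (2 * suc β + k * e') ≤ M (suc (α + β)) (e + e') + 2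
    mixed α β e e' = ≤-trans bound (+-monoˡ-≤ 2 (M-convex (suc (α + β)) e e'))
      where
      lem : ∀ α β x q → suc α * (2 * suc x) + (2 * suc β + q) + 0 + 2 * (β * x) ≡ suc (α + β) * (2 * suc x) + q + 2 + 0
      lem = solve-∀
      bound : suc α * 2 ^ suc e + (2 * suc β + k * e') ≤ suc (α + β) * 2 ^ suc e + k * e' + 2
      bound with 2 ^ e | pos e
      ... | _ | x , refl = linear {0} {0} (2 * (β * x)) z≤n (lem α β x (k * e'))
    ll : suc α * 2 ^ suc e + suc β * 2 ^ suc e' ≤ M t (e + e') + 2
    ll = ≤-trans bound (+-monoˡ-≤ 2
        (≤-trans (≤-reflexive (cong (λ p → t * (2 * p)) (sym (^-distribˡ-+-* 2 e e')))) (l≤M t (e + e'))))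
      where
      lem : ∀ α β x y → suc α * (2 * suc x) + suc β * (2 * suc y) + 0 + 2 * (x * y + α * (y + x * y) + β * (x + x * y))
            ≡ suc (α + β) * (2 * (suc x * suc y)) + 2 + 0
      lem = solve-∀
      bound : suc α * 2 ^ suc e + suc β * 2 ^ suc e' ≤ t * (2 * (2 ^ e * 2 ^ e')) + 2
      bound with 2 ^ e | pos e | 2 ^ e' | pos e'
      ... | _ | x , refl | _ | y , refl = linear {0} {0} (2 * (x * y + α * (y + x * y) + β * (x + x * y))) z≤n (lem α β x y)
    lw : suc α * 2 ^ suc e + (2 * suc β + k * e') ≤ M t (e + e') + 2
    lw = mixed α β e e'
    wl : (2 * suc α + k * e) + suc β * 2 ^ suc e' ≤ M t (e + e') + 2
    wl = ≤-trans (≤-reflexive (+-comm (2 * suc α + k * e) _)) (≤-trans (mixed β α e' e)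
      (≤-reflexive (cong₂ (λ a b → M (suc a) b + 2) (+-comm β α) (+-comm e' e))))
    ww : (2 * suc α + k * e) + (2 * suc β + k * e') ≤ M t (e + e') + 2
    ww = ≤-trans (≤-reflexive (lem k α β e e')) (+-monoˡ-≤ 2 (w≤M t (e + e')))
      where
      lem : ∀ k α β e e' → (2 * suc α + k * e) + (2 * suc β + k * e') ≡ 2 * suc (α + β) + k * (e + e') + 2
      lem = solve-∀

  module _ .{{_ : NonZero k}} where

    p : ℕ → ℕ → ℕ
    p t n = pt t n k

    -- Both terms of the maximum contain the remainder `m % k`, which can therefore be taken out.
    p-normal : ∀ t m → p t (2 + m) ≡ M t (m / k) + m % k
    p-normal t m = begin
      (t * 2 ^ (m / k + 1) + (m ∸ k * (m / k + 1 ∸ 1))) ⊔ (2 * t + (2 + m) ∸ 2)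
        ≡⟨ cong₂ _⊔_ (cong₂ (λ a b → t * 2 ^ a + (m ∸ k * b)) (+-comm (m / k) 1) (m+n∸n≡m (m / k) 1)) w ⟩
      (t * 2 ^ suc (m / k) + (m ∸ k * (m / k))) ⊔ (2 * t + k * (m / k) + m % k)
        ≡⟨ cong (λ b → (t * 2 ^ suc (m / k) + b) ⊔ (2 * t + k * (m / k) + m % k))
             (trans (cong (m ∸_) (*-comm k _)) (sym (m%n≡m∸m/n*n m k))) ⟩
      (t * 2 ^ suc (m / k) + m % k) ⊔ (2 * t + k * (m / k) + m % k)
        ≡⟨ +-distribʳ-⊔ (m % k) (t * 2 ^ suc (m / k)) (2 * t + k * (m / k)) ⟨
      M t (m / k) + m % k ∎
      where
      open ≡-Reasoning
      lem : ∀ t m → 2 * t + (2 + m) ≡ 2 + (2 * t + m)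
      lem = solve-∀
      lem' : ∀ t q r → 2 * t + (r + q) ≡ 2 * t + q + r
      lem' = solve-∀
      w : 2 * t + (2 + m) ∸ 2 ≡ 2 * t + k * (m / k) + m % k
      w = trans (cong (_∸ 2) (lem t m)) (trans (cong (2 * t +_) (m≡m%n+[m/n]*n m k))
        (trans (lem' t (m / k * k) (m % k)) (cong (λ q → 2 * t + q + m % k) (*-comm (m / k) k))))

    division : ∀ m → m ≡ k * (m / k) + m % k
    division m = trans (m≡m%n+[m/n]*n m k) (trans (+-comm (m % k) _) (cong (_+ m % k) (*-comm (m / k) k)))

    -- Here `b` may be `k` or more: the `j` full blocks it contains are moved into the second
    -- argument of `M` by `M-extend`, which can only raise the value.
    M≤p : ∀ t e b → M t e + b ≤ p t (2 + (k * e + b))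
    M≤p t e b = begin
      M t e + b                     ≡⟨ cong (M t e +_) (+-cancelˡ-≡ (k * e) _ _ eq) ⟩
      M t e + (k * j + m % k)       ≡⟨ +-assoc (M t e) _ _ ⟨
      M t e + k * j + m % k         ≤⟨ +-monoˡ-≤ (m % k) (M-extend t e j) ⟩
      M t (e + j) + m % k           ≡⟨ cong (λ q → M t q + m % k) e+j ⟩
      M t (m / k) + m % k           ≡⟨ p-normal t m ⟨
      p t (2 + m)                   ∎
      where
      open ≤-Reasoning
      m = k * e + b
      j = m / k ∸ e
      e≤ : e ≤ m / k
      e≤ = ≤-trans (≤-reflexive (trans (sym (m*n/n≡m e k)) (cong (_/ k) (*-comm e k)))) (/-monoˡ-≤ k (m≤m+n (k * e) b))
      e+j : e + j ≡ m / k
      e+j = m+[n∸m]≡n e≤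
      eq : k * e + b ≡ k * e + (k * j + m % k)
      eq = trans (division m) (trans (cong (λ q → k * q + m % k) (sym e+j))
        (trans (cong (_+ m % k) (*-distribˡ-+ k e j)) (+-assoc (k * e) _ _)))

    w≤p : ∀ t n → 2 * t + n ≤ 2 + p t n
    w≤p t n = ≤-trans (m≤n+m∸n (2 * t + n) 2) (+-monoʳ-≤ 2 (m≤n⊔m _ _))

    p-suc : ∀ t n → p t (2 + n) + 2 ≤ p (suc t) (2 + n)
    p-suc t n rewrite p-normal t n | p-normal (suc t) n =
      ≤-trans (≤-reflexive (lem (M t (n / k)) (n % k))) (+-monoˡ-≤ (n % k) (M-suc t (n / k)))
      where
      lem : ∀ a b → a + b + 2 ≡ a + 2 + b
      lem = solve-∀

    p-+ : ∀ t u n → p t (2 + n) + 2 * u ≤ p (t + u) (2 + n)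
    p-+ t zero    n = ≤-reflexive (trans (+-identityʳ _) (cong (λ s → p s (2 + n)) (sym (+-identityʳ t))))
    p-+ t (suc u) n = begin
      p t (2 + n) + 2 * suc u       ≡⟨ lem (p t (2 + n)) u ⟩
      p t (2 + n) + 2 * u + 2       ≤⟨ +-monoˡ-≤ 2 (p-+ t u n) ⟩
      p (t + u) (2 + n) + 2         ≤⟨ p-suc (t + u) n ⟩
      p (suc (t + u)) (2 + n)       ≡⟨ cong (λ s → p s (2 + n)) (+-suc t u) ⟨
      p (t + suc u) (2 + n)         ∎
      where
      open ≤-Reasoning
      lem : ∀ a u → a + 2 * suc u ≡ a + 2 * u + 2
      lem = solve-∀

    -- One more vertex raises the remainder by one; `M≤p` also covers the case where it reaches `k`.
    p-delete : ∀ t n → p t (2 + n) < p t (3 + n)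
    p-delete t n = begin
      suc (p t (2 + n))                  ≡⟨ cong suc (p-normal t n) ⟩
      suc (M t (n / k) + n % k)          ≡⟨ +-suc _ _ ⟨
      M t (n / k) + suc (n % k)          ≤⟨ M≤p t (n / k) (suc (n % k)) ⟩
      p t (2 + (k * (n / k) + suc (n % k))) ≡⟨ cong (λ m → p t (2 + m)) (trans (+-suc _ _) (cong suc (sym (division n)))) ⟩
      p t (3 + n)                        ∎
      where open ≤-Reasoning

    p-double : ∀ t n → p (2 * t) (2 + n) ≤ p t (k + (2 + n))
    p-double t n = begin
      p (2 * t) (2 + n)                  ≡⟨ p-normal (2 * t) n ⟩
      M (2 * t) (n / k) + n % k          ≤⟨ +-monoˡ-≤ (n % k) (M-double t (n / k)) ⟩
      M t (suc (n / k)) + n % k          ≤⟨ M≤p t (suc (n / k)) (n % k) ⟩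
      p t (2 + (k * suc (n / k) + n % k)) ≡⟨ cong (p t) (trans (cong (2 +_) (trans (cong (_+ n % k) (*-suc k _))
          (trans (+-assoc k _ _) (cong (k +_) (sym (division n)))))) (lem k n)) ⟩
      p t (k + (2 + n))                  ∎
      where
      open ≤-Reasoning
      lem : ∀ k n → 2 + (k + n) ≡ k + (2 + n)
      lem = solve-∀

    -- Sides with 2 + m and 2 + r vertices sharing one make 3 + m + r in all. Of the 2 lost in
    -- `M-superadd`, one unit is absorbed by the vertex count, as the last summand of the remainder
    -- `m % k + r % k + 1`; this may reach `k`, which `M≤p` permits.
    p-superadd : ∀ α β m r → p (suc α) (2 + m) + p (suc β) (2 + r) ≤ p (suc (α + β)) (2 + (m + suc r)) + 1
    p-superadd α β m r = begin
      p (suc α) (2 + m) + p (suc β) (2 + r)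
        ≡⟨ cong₂ _+_ (p-normal (suc α) m) (p-normal (suc β) r) ⟩
      (M (suc α) (m / k) + m % k) + (M (suc β) (r / k) + r % k)
        ≤⟨ linear 0 (M-superadd α β (m / k) (r / k))
            (lem (M (suc α) (m / k)) (m % k) (M (suc β) (r / k)) (r % k) (M t (m / k + r / k))) ⟩
      M t (m / k + r / k) + (m % k + r % k + 1) + 1
        ≤⟨ +-monoˡ-≤ 1 (M≤p t (m / k + r / k) (m % k + r % k + 1)) ⟩
      p t (2 + (k * (m / k + r / k) + (m % k + r % k + 1))) + 1
        ≡⟨ cong (λ q → p t (2 + q) + 1) (trans (lem' k (m / k) (r / k) (m % k) (r % k))
             (cong₂ (λ a b → a + suc b) (sym (division m)) (sym (division r)))) ⟩
      p t (2 + (m + suc r)) + 1 ∎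
      where
      open ≤-Reasoning
      t = suc (α + β)
      lem : ∀ a b c d x → (a + b) + (c + d) + (x + 2) + 0 ≡ x + (b + d + 1) + 1 + (a + c)
      lem = solve-∀
      lem' : ∀ k a c b d → k * (a + c) + (b + d + 1) ≡ k * a + b + suc (k * c + d)
      lem' = solve-∀

-- Counting removed, matched and merged pebbles.

drop : ℕ → ℕ → (ℕ → ℕ) → ℕ → ℕ
drop c a f i = f i ∸ c * δ a i

∑-drop-* : ∀ n {c a} f g → a < n → c ≤ f a → ∑ n (λ i → f i * g i) ≡ ∑ n (λ i → drop c a f i * g i) + c * g a
∑-drop-* n {c} {a} f g a<n c≤ = begin
  ∑ n (λ i → f i * g i)
    ≡⟨ ∑-cong n (λ i _ → cong (_* g i) (sym (m∸n+n≡m ((f δ≤ c≤) i)))) ⟩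
  ∑ n (λ i → (drop c a f i + c * δ a i) * g i)
    ≡⟨ ∑-cong n (λ i _ → lem (drop c a f i) c (δ a i) (g i)) ⟩
  ∑ n (λ i → drop c a f i * g i + c * (δ a i * g i))
    ≡⟨ ∑-+ n _ _ ⟩
  ∑ n (λ i → drop c a f i * g i) + ∑ n (λ i → c * (δ a i * g i))
    ≡⟨ cong (∑ n (λ i → drop c a f i * g i) +_) (trans (∑-* n c _) (cong (c *_) (∑-δ n g a<n))) ⟩
  ∑ n (λ i → drop c a f i * g i) + c * g a ∎
  where
  open ≡-Reasoning
  lem : ∀ d c e g → (d + c * e) * g ≡ d * g + c * (e * g)
  lem = solve-∀

∑-drop : ∀ n {c a} f → a < n → c ≤ f a → ∑ n f ≡ ∑ n (drop c a f) + c
∑-drop n {c} {a} f a<n c≤ = begin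
  ∑ n f                                    ≡⟨ ∑-cong n (λ i _ → *-identityʳ (f i)) ⟨
  ∑ n (λ i → f i * 1)                      ≡⟨ ∑-drop-* n f (λ _ → 1) a<n c≤ ⟩
  ∑ n (λ i → drop c a f i * 1) + c * 1     ≡⟨ cong₂ _+_ (∑-cong n λ i _ → *-identityʳ _) (*-identityʳ c) ⟩
  ∑ n (drop c a f) + c                     ∎
  where open ≡-Reasoning

ind-δ : ∀ {f : ℕ → ℕ} {a} → f a ≡ 0 → ∀ i → ind (f i) + δ a i ≤ ind (f i + δ a i)
ind-δ {f} {a} fa≡0 i with a ≟ i
... | yes refl rewrite fa≡0 | δ-refl a = ≤-refl
... | no  a≢i  rewrite δ-≢ a≢i | +-identityʳ (ind (f i)) | +-identityʳ (f i) = ≤-refl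

2≤⇐ind< : ∀ {c} → ind c < c → 2 ≤ c
2≤⇐ind< {suc c} lt = lt

-- Each missing unit costs two pebbles, and an occupied surplus vertex may waste one. Summed over
-- the vertices and combined with `w≤p`, this yields the pair count that `assign` requires.
match-cost : ∀ c d → 2 * (d ∸ c) + ind (c ∸ d) + (c + ind d) ≤ (c ∸ d) + (2 * d + 1)
match-cost zero    zero    = z≤n
match-cost zero    (suc d) = ≤-reflexive (cong (_+ 1) (+-identityʳ (2 * suc d)))
match-cost (suc c) zero    = ≤-reflexive (trans (cong (1 +_) (+-identityʳ (suc c))) (+-comm 1 (suc c)))
match-cost (suc c) (suc d) = linear {b = (c ∸ d) + (2 * d + 1)} (ind d) (match-cost c d)
    (lem (d ∸ c) (ind (c ∸ d)) c (c ∸ d) d (ind d))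
  where
  lem : ∀ e i c f d j → 2 * e + i + (suc c + 1) + (f + (2 * d + 1)) + j ≡ f + (2 * suc d + 1) + (2 * e + i + (c + j))
  lem = solve-∀

∑-match-cost : ∀ n C D →
  2 * ∑ n (λ i → D i ∸ C i) + ∑ n (λ i → ind (C i ∸ D i)) + (∑ n C + ∑ n (ind ∘ D))
  ≤ ∑ n (λ i → C i ∸ D i) + (2 * ∑ n D + n)
∑-match-cost n C D = begin
  2 * ∑ n e + ∑ n q + (∑ n C + ∑ n (ind ∘ D))
    ≡⟨ cong₂ (λ a b → a + ∑ n q + b) (∑-* n 2 e) (∑-+ n C (ind ∘ D)) ⟨
  ∑ n (λ i → 2 * e i) + ∑ n q + ∑ n (λ i → C i + ind (D i))
    ≡⟨ cong (_+ ∑ n (λ i → C i + ind (D i))) (∑-+ n (λ i → 2 * e i) q) ⟨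
  ∑ n (λ i → 2 * e i + q i) + ∑ n (λ i → C i + ind (D i))
    ≡⟨ ∑-+ n (λ i → 2 * e i + q i) (λ i → C i + ind (D i)) ⟨
  ∑ n (λ i → 2 * e i + q i + (C i + ind (D i)))
    ≤⟨ ∑-mono n (λ i _ → match-cost (C i) (D i)) ⟩
  ∑ n (λ i → f i + (2 * D i + 1))
    ≡⟨ ∑-+ n f (λ i → 2 * D i + 1) ⟩
  ∑ n f + ∑ n (λ i → 2 * D i + 1)
    ≡⟨ cong (∑ n f +_) (trans (∑-+ n (λ i → 2 * D i) (λ _ → 1)) (cong₂ _+_ (∑-* n 2 D) (∑-1 n))) ⟩
  ∑ n f + (2 * ∑ n D + n) ∎
  where
  open ≤-Reasoning
  e = λ i → D i ∸ C i
  q = λ i → ind (C i ∸ D i)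
  f = λ i → C i ∸ D i

-- Adding the doubled demand to a vertex can merge two support points into one. That happens only if
-- `d` is positive, so the loss is charged to `d`.
merge-cost : ∀ c d → ind c + ind d ≤ ind (d + 2 * c) + d
merge-cost zero    d       rewrite +-identityʳ d = m≤m+n _ _
merge-cost (suc c) zero    = ≤-refl
merge-cost (suc c) (suc d) = s≤s (s≤s z≤n)

-- The search descends from `e` and returns the last switch from success to failure.
first-failure : ∀ {P : ℕ → Set} → (∀ a → Dec (P a)) → ∀ e → P 0 → ¬ P e → ∃ λ a → a < e × P a × ¬ P (suc a)
first-failure P? zero    p0 ¬pe = contradiction p0 ¬pe
first-failure P? (suc e) p0 ¬pe with P? e
... | yes pe = e , ≤-refl , pe , ¬pe
... | no ¬pe' with first-failure P? e p0 ¬pe'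
...   | a , a<e , pa , ¬psa = a , m<n⇒m<1+n a<e , pa , ¬psa

n∸[1+i]<n : ∀ {n i} → i < n → n ∸ suc i < n
n∸[1+i]<n {suc n} {i} _ = s≤s (m∸n≤m n i)

∣-∣-reverse : ∀ {n i j} → i < n → j < n → ∣ n ∸ suc i - n ∸ suc j ∣ ≡ ∣ i - j ∣
∣-∣-reverse {n} {i} {j} i<n j<n = begin
  ∣ i' - j' ∣                               ≡⟨ ∣m+n-m+o∣≡∣n-o∣ (suc i + suc j) i' j' ⟨
  ∣ suc i + suc j + i' - suc i + suc j + j' ∣ ≡⟨ cong₂ ∣_-_∣ eq₁ eq₂ ⟩
  ∣ n + suc j - n + suc i ∣                 ≡⟨ ∣m+n-m+o∣≡∣n-o∣ n (suc j) (suc i) ⟩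
  ∣ j - i ∣                                 ≡⟨ ∣-∣-comm j i ⟩
  ∣ i - j ∣                                 ∎
  where
  open ≡-Reasoning
  i' = n ∸ suc i
  j' = n ∸ suc j
  lem₁ : ∀ a b c → a + b + c ≡ (a + c) + b
  lem₁ = solve-∀
  lem₂ : ∀ a b c → a + b + c ≡ (b + c) + a
  lem₂ = solve-∀
  eq₁ : suc i + suc j + i' ≡ n + suc j
  eq₁ = trans (lem₁ (suc i) (suc j) i') (cong (_+ suc j) (m+[n∸m]≡n i<n))
  eq₂ : suc i + suc j + j' ≡ n + suc i
  eq₂ = trans (lem₂ (suc i) (suc j) j') (cong (_+ suc i) (m+[n∸m]≡n j<n))

-- Transport along a path of tokens, and the induction predicates.

module PathPower (N k : ℕ) .{{_ : NonZero k}} where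

  open Conversion N k
  open Bound k

  1≤k : 1 ≤ k
  1≤k = >-nonZero⁻¹ k

  load-drop : ∀ n x {c a} C v → a < n → c ≤ C a → load n x C v ≡ load n x (drop c a C) v + c * x a v
  load-drop n x C v = ∑-drop-* n C (λ i → x i v)

  -- While demand remains, the inequality forces fewer occupied vertices than pebbles, so some
  -- vertex holds two; they pay for any unmet unit. The total falls by two and `t` by one, the
  -- number of occupied vertices does not rise, and the inequality persists.
  assign : ∀ t n n' {x y} C D → (∀ i j → i < n → j < n' → 2 · x i ⟹ y j) → ∑ n' D ≡ t →
    2 * t + ∑ n (ind ∘ C) ≤ ∑ n C + 1 → load n x C ⟹ load n' y D
  assign zero n n' {y = y} C D mv eq _ = ≼⇒⟹ λ v → ≤-trans (≤-reflexive (load-zero n' y eq v)) z≤n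
  assign (suc t) n n' {x} {y} C D mv eq le
    with ∑-<⇒∃ n' {λ _ → 0} {D} (subst (_< ∑ n' D) (sym (∑-zero n' λ _ _ → refl)) (subst (0 <_) (sym eq) (s≤s z≤n)))
       | ∑-<⇒∃ n {ind ∘ C} {C} (linear (2 * t) le (lem t (∑ n (ind ∘ C)) (∑ n C)))
    where
    lem : ∀ t q c → suc q + (c + 1) + 2 * t ≡ c + (2 * suc t + q)
    lem = solve-∀
  ... | j , j<n' , 0<Dj | i , i<n , lt =
    ⟹-trans (≼⇒⟹ λ v → ≤-reflexive (sym (load-drop n x C v i<n 2≤)))
    (⟹-trans (⟹-⊕ (assign t n n' (drop 2 i C) (drop 1 j D) mv eq' le') (mv i j i<n j<n'))
    (≼⇒⟹ λ v → ≤-reflexive (trans (load-drop n' y D v j<n' 0<Dj) (cong (load n' y (drop 1 j D) v +_) (*-identityˡ _)))))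
    where
    2≤ = 2≤⇐ind< lt
    eq' : ∑ n' (drop 1 j D) ≡ t
    eq' = suc-injective (trans (+-comm 1 _) (trans (sym (∑-drop n' D j<n' 0<Dj)) eq))
    lem : ∀ t q q' c' → 2 * t + q' + (c' + 2 + 1 + q) + 0 ≡ c' + 1 + (2 * suc t + q + q')
    lem = solve-∀
    le' : 2 * t + ∑ n (ind ∘ drop 2 i C) ≤ ∑ n (drop 2 i C) + 1
    le' = linear 0 (+-mono-≤ (subst (λ c → 2 * suc t + ∑ n (ind ∘ C) ≤ c + 1) (∑-drop n C i<n 2≤) le)
                           (∑-mono n {ind ∘ drop 2 i C} {ind ∘ C} λ i' _ → ind-mono (m∸n≤m (C i') (2 * δ i i'))))
            (lem t (∑ n (ind ∘ C)) (∑ n (ind ∘ drop 2 i C)) (∑ n (drop 2 i C)))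

  -- All that the induction uses of the graph, in a form inherited by intervals and reversals of the
  -- path.
  Tok : ℕ → (ℕ → Config N) → Set
  Tok n x = ∀ {i j} → i < n → j < n → i ≢ j → ∣ i - j ∣ ≤ k → 2 · x i ⟹ x j

  -- Zero demand is a separate alternative because one side of a cut may carry none, and then the
  -- inequality can fail: p_0(n) = n - 2 need not be below the number of pebbles.
  Good : ℕ → (ℕ → ℕ) → (ℕ → ℕ) → Set
  Good n C D = ∑ n D ≡ 0 ⊎ p (∑ n D) n < ∑ n C + ∑ n (ind ∘ D)

  good? : ∀ n C D → Dec (Good n C D)
  good? n C D = (∑ n D ≟ 0) ⊎-dec (p (∑ n D) n <? ∑ n C + ∑ n (ind ∘ D))

  Disjoint : ℕ → (ℕ → ℕ) → (ℕ → ℕ) → Set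
  Disjoint n C D = ∀ i → i < n → C i ≡ 0 ⊎ D i ≡ 0

  Below : ℕ → Set
  Below s = ∀ n x C D → n + ∑ n C < s → Tok n x → Good n C D → load n x C ⟹ load n x D

  Tok-suffix : ∀ m n x → Tok (m + n) x → Tok n (x ∘ (m +_))
  Tok-suffix m n x tok {i} {j} i<n j<n i≢j d = tok (+-monoʳ-< m i<n) (+-monoʳ-< m j<n)
    (i≢j ∘ +-cancelˡ-≡ m i j) (subst (_≤ k) (sym (∣m+n-m+o∣≡∣n-o∣ m i j)) d)

  Tok-prefix : ∀ {m n x} → m ≤ n → Tok n x → Tok m x
  Tok-prefix m≤n tok i<m j<m = tok (<-≤-trans i<m m≤n) (<-≤-trans j<m m≤n)

  Tok-reverse : ∀ {n x} → Tok n x → Tok n (λ i → x (n ∸ suc i))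
  Tok-reverse {n} tok {i} {j} i<n j<n i≢j d = tok (n∸[1+i]<n i<n) (n∸[1+i]<n j<n)
    (λ e → i≢j (∣m-n∣≡0⇒m≡n (trans (sym (∣-∣-reverse i<n j<n)) (m≡n⇒∣m-n∣≡0 e))))
    (subst (_≤ k) (sym (∣-∣-reverse i<n j<n)) d)

  -- Short paths, and paths with a demanded end.

  clique : ∀ {n x C D} → n ≤ suc k → Tok n x → p (∑ n D) n < ∑ n C + ∑ n (ind ∘ D) → load n x C ⟹ load n x D
  clique {n} {x} {C} {D} n≤ tok lt = match n x C D (assign _ n n (λ i → C i ∸ D i) (λ i → D i ∸ C i) mv refl le)
    where
    mv : ∀ i j → i < n → j < n → 2 · x i ⟹ x j
    mv i j i<n j<n with i ≟ j
    ... | yes refl = ≼⇒⟹ λ v → m≤m+n _ _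
    ... | no i≢j   = tok i<n j<n i≢j
      (≤-trans (∣m-n∣≤m⊔n i j) (s≤s⁻¹ (≤-trans (⊔-lub i<n j<n) n≤)))
    lem : ∀ e q c f d n p → 2 * e + q + ((f + (2 * d + n)) + (2 + p) + c) + 0 ≡ f + 1 + ((2 * e + q + c) + (2 * d + n) + suc p)
    lem = solve-∀
    le : 2 * ∑ n (λ i → D i ∸ C i) + ∑ n (λ i → ind (C i ∸ D i)) ≤ ∑ n (λ i → C i ∸ D i) + 1
    le = linear 0 (+-mono-≤ (+-mono-≤ (∑-match-cost n C D) (w≤p (∑ n D) n)) lt)
      (lem (∑ n (λ i → D i ∸ C i)) (∑ n (λ i → ind (C i ∸ D i))) (∑ n C + ∑ n (ind ∘ D)) (∑ n (λ i → C i ∸ D i)) (∑ n D) n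
          (p (∑ n D) n))

  -- A demand on vertex i < m is met by doubling it at the vertex k further on.
  fold : ℕ → ℕ → (ℕ → ℕ) → ℕ → ℕ
  fold m o D i = D (o + i) + 2 * cat m D (λ _ → 0) i

  ∑-fold : ∀ m r o D → ∑ (m + r) (fold m o D) ≡ ∑ (m + r) (D ∘ (o +_)) + 2 * ∑ m D
  ∑-fold m r o D = trans (∑-+ (m + r) (D ∘ (o +_)) (λ i → 2 * cat m D (λ _ → 0) i)) (cong (∑ (m + r) (D ∘ (o +_)) +_)
    (trans (∑-* (m + r) 2 _) (cong (2 *_)
        (trans (∑-cat m r D (λ _ → 0) (λ c _ → c)) (trans (cong (∑ m D +_) (∑-zero r λ _ _ → refl)) (+-identityʳ _))))))

  ∑-ind-fold : ∀ m r o D → ∑ m (ind ∘ D) + ∑ (m + r) (ind ∘ D ∘ (o +_)) ≤ ∑ (m + r) (ind ∘ fold m o D) + ∑ (m + r) (D ∘ (o +_))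
  ∑-ind-fold m r o D = begin
    ∑ m (ind ∘ D) + ∑ (m + r) (ind ∘ D ∘ (o +_))
      ≡⟨ cong (_+ ∑ (m + r) (ind ∘ D ∘ (o +_))) (trans (∑-cat m r D (λ _ → 0) (λ c _ → ind c))
           (trans (cong (∑ m (ind ∘ D) +_) (∑-zero r λ _ _ → refl)) (+-identityʳ _))) ⟨
    ∑ (m + r) (λ i → ind (cat m D (λ _ → 0) i)) + ∑ (m + r) (ind ∘ D ∘ (o +_))
      ≡⟨ ∑-+ (m + r) (λ i → ind (cat m D (λ _ → 0) i)) (ind ∘ D ∘ (o +_)) ⟨
    ∑ (m + r) (λ i → ind (cat m D (λ _ → 0) i) + ind (D (o + i)))
      ≤⟨ ∑-mono (m + r) (λ i _ → merge-cost (cat m D (λ _ → 0) i) (D (o + i))) ⟩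
    ∑ (m + r) (λ i → ind (fold m o D i) + D (o + i))
      ≡⟨ ∑-+ (m + r) (ind ∘ fold m o D) (D ∘ (o +_)) ⟩
    ∑ (m + r) (ind ∘ fold m o D) + ∑ (m + r) (D ∘ (o +_)) ∎
    where open ≤-Reasoning

  load-fold : ∀ m r o {x y} D → (∀ i → i < m → 2 · y i ⟹ x i) →
    load (m + r) y (fold m o D) ⟹ load m x D ⊕ load (m + r) y (D ∘ (o +_))
  load-fold m r o {x} {y} D mv = ⟹-trans (≼⇒⟹ λ v → ≤-reflexive (sym (split v)))
      (⟹-⊕ˡ (load (m + r) y (D ∘ (o +_))) (load-⟹ m D mv))
    where
    open ≡-Reasoning
    split : ∀ v → load (m + r) y (fold m o D) v ≡ 2 * load m y D v + load (m + r) y (D ∘ (o +_)) v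
    split v = begin
      load (m + r) y (fold m o D) v
        ≡⟨ load-+ (m + r) y (D ∘ (o +_)) (λ i → 2 * cat m D (λ _ → 0) i) v ⟩
      load (m + r) y (D ∘ (o +_)) v + load (m + r) y (λ i → 2 * cat m D (λ _ → 0) i) v
        ≡⟨ cong (load (m + r) y (D ∘ (o +_)) v +_) (trans (load-* (m + r) y 2 (cat m D (λ _ → 0)) v) (cong (2 *_)
             (trans (load-cat m r y D (λ _ → 0) v) (trans (cong (load m y D v +_) (∑-zero r λ _ _ → refl)) (+-identityʳ _))))) ⟩
      load (m + r) y (D ∘ (o +_)) v + 2 * load m y D v
        ≡⟨ +-comm (load (m + r) y (D ∘ (o +_)) v) _ ⟩
      2 * load m y D v + load (m + r) y (D ∘ (o +_)) v ∎

  mv-back : ∀ {n x i} → Tok n x → k + i < n → 2 · x (k + i) ⟹ x i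
  mv-back {i = i} tok lt = tok lt (≤-<-trans (m≤n+m i k) lt)
    (>⇒≢ (m<n+m i 1≤k))
    (≤-reflexive (trans (∣-∣-comm (k + i) i) (trans (cong (λ j → ∣ i - j ∣) (+-comm k i)) (∣m-m+n∣≡n i k))))

  -- From n ≥ 2k + 2, at least k + 2 vertices remain after the deletion, so every doubled demand
  -- finds its place among them.
  far : ∀ {n q x C D} → n ≡ k + (k + suc (suc q)) → Below (n + ∑ n C) → Tok n x →
    (∀ i → i < k → C i ≡ 0) → p (∑ n D) n < ∑ n C + ∑ n (ind ∘ D) → load n x C ⟹ load n x D
  far {q = q} {x} {C} {D} refl ih tok C0 lt =
    ⟹-trans (≼⇒⟹ λ v → ≤-trans (m≤n+m _ (load k x C v)) (≤-reflexive (sym (load-split k r x C v))))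
    (⟹-trans (ih r (x ∘ (k +_)) (C ∘ (k +_)) D' size< (Tok-suffix k r x tok) (inj₂ good))
    (⟹-trans (load-fold k (suc (suc q)) k {x = x} D (λ i i<k → mv-back {i = i} tok (+-monoʳ-< k (<-≤-trans i<k (m≤m+n k _)))))
    (≼⇒⟹ λ v → ≤-reflexive (load-split k r x D v))))
    where
    r = k + suc (suc q)
    r≡ : r ≡ 2 + (k + q)
    r≡ = trans (+-suc k (suc q)) (cong suc (+-suc k q))
    D' = fold k k D
    ∑C : ∑ (k + r) C ≡ ∑ r (C ∘ (k +_))
    ∑C = trans (∑-split k r C) (cong (_+ ∑ r (C ∘ (k +_))) (∑-zero k C0))
    size< : r + ∑ r (C ∘ (k +_)) < k + r + ∑ (k + r) C
    size< = +-mono-<-≤ (+-monoˡ-≤ r 1≤k) (≤-reflexive (sym ∑C))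
    a = ∑ k D
    b = ∑ r (D ∘ (k +_))
    t≡ : ∑ (k + r) D ≡ a + b
    t≡ = ∑-split k r D
    t'≡ : ∑ r D' ≡ b + 2 * a
    t'≡ = ∑-fold k (suc (suc q)) k D
    -- The folded demand b + 2a falls short of 2(a + b) by b. By `p-+` this frees 2b in the bound,
    -- of which b pays for the support lost in merging.
    p≤ : p (∑ r D') r + 2 * b ≤ p (∑ (k + r) D) (k + r)
    p≤ = begin
      p (∑ r D') r + 2 * b                ≡⟨ cong₂ (λ t n → p t n + 2 * b) t'≡ r≡ ⟩
      p (b + 2 * a) (2 + (k + q)) + 2 * b ≤⟨ p-+ (b + 2 * a) b (k + q) ⟩
      p (b + 2 * a + b) (2 + (k + q))     ≡⟨ cong (λ t → p t (2 + (k + q))) (lem a b) ⟩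
      p (2 * (a + b)) (2 + (k + q))       ≤⟨ p-double (a + b) (k + q) ⟩
      p (a + b) (k + (2 + (k + q)))       ≡⟨ cong₂ (λ t n → p t (k + n)) t≡ r≡ ⟨
      p (∑ (k + r) D) (k + r)             ∎
      where
      open ≤-Reasoning
      lem : ∀ a b → b + 2 * a + b ≡ 2 * (a + b)
      lem = solve-∀
    good : p (∑ r D') r < ∑ r (C ∘ (k +_)) + ∑ r (ind ∘ D')
    good = linear b (+-mono-≤ (+-mono-≤ p≤ lt) (≤-trans (≤-reflexive (∑-split k r (ind ∘ D))) (∑-ind-fold k (suc (suc q)) k D)))
      (trans (cong (λ c → suc (p (∑ r D') r) +
          (p (∑ (k + r) D) (k + r) + (c + ∑ (k + r) (ind ∘ D)) + (∑ r (ind ∘ D') + b)) + b) ∑C)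
        (lem (p (∑ r D') r) b (p (∑ (k + r) D) (k + r)) (∑ r (C ∘ (k +_))) (∑ (k + r) (ind ∘ D)) (∑ r (ind ∘ D'))))
      where
      lem : ∀ p' b p c s s' → suc p' + (p + (c + s) + (s' + b)) + b ≡ c + s' + (p' + 2 * b + suc p + s)
      lem = solve-∀

  -- Here k + 2 ≤ n ≤ 2k + 1 and the diameter is two. Demands on the first n - k - 1 positions are
  -- folded onto the positions from k on. The `r` positions that follow the folded ones are free of
  -- pebbles and form a clique of k + 1 with the last n - k.
  near : ∀ {n m r x C D} → n ≡ k + (suc m + 1) → suc m + r ≡ k → Tok n x →
    (∀ i → i < k → C i ≡ 0) → p (∑ n D) n < ∑ n C + ∑ n (ind ∘ D) → load n x C ⟹ load n x D
  near {m = m'} {r} {x} {C} {D} refl k≡ tok C0 lt =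
    ⟹-trans (≼⇒⟹ λ v → ≤-trans (m≤n+m _ (load k x C v)) (≤-reflexive (sym (load-split k h x C v))))
    (⟹-trans (match-⊕ h z C' E (load r y Nd)
      (⟹-trans (assign _ h (r + h) {z} {y} (λ i → C' i ∸ E i) (cat r Nd Ed) mv refl cost) (≼⇒⟹ λ v → ≤-reflexive (collect v))))
    (⟹-trans (⟹-⊕ˡ (load r y Nd) (load-fold m 1 k {x} {z} D back))
    (≼⇒⟹ λ v → ≤-reflexive (regroup v))))
    where
    m = suc m'
    h = m + 1
    y z : ℕ → Config N
    y = x ∘ (m +_)
    z = x ∘ (k +_)
    C' E Ed Nd : ℕ → ℕ
    C' = C ∘ (k +_)
    E = fold m k D
    Ed i = E i ∸ C' i
    Nd = D ∘ (m +_)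
    back : ∀ i → i < m → 2 · z i ⟹ x i
    back i i<m = mv-back {i = i} tok (+-monoʳ-< k (<-≤-trans i<m (m≤m+n m 1)))
    shift : ∀ i → m + (r + i) ≡ k + i
    shift i = trans (sym (+-assoc m r i)) (cong (_+ i) k≡)
    ∑k : ∀ (f : ℕ → ℕ) → ∑ k f ≡ ∑ m f + ∑ r (f ∘ (m +_))
    ∑k f = trans (cong (λ q → ∑ q f) (sym k≡)) (∑-split m r f)
    mv : ∀ i j → i < h → j < r + h → 2 · z i ⟹ y j
    -- The destinations include the sources themselves, where no pebbling step is needed.
    mv i j i<h j<rh with k + i ≟ m + j
    ... | yes e = subst (λ l → 2 · z i ⟹ x l) e (≼⇒⟹ λ v → m≤m+n _ _)
    ... | no ne = tok (+-monoʳ-< k i<h) (<-≤-trans (+-monoʳ-< m j<rh) (≤-reflexive (shift h))) ne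
      (begin
        ∣ k + i - m + j ∣         ≡⟨ cong (λ l → ∣ l - m + j ∣) (shift i) ⟨
        ∣ m + (r + i) - m + j ∣   ≡⟨ ∣m+n-m+o∣≡∣n-o∣ m (r + i) j ⟩
        ∣ r + i - j ∣             ≤⟨ ∣m-n∣≤m⊔n (r + i) j ⟩
        (r + i) ⊔ j               ≤⟨ s≤s⁻¹
            (≤-trans (⊔-lub (+-monoʳ-< r i<h) j<rh) (≤-reflexive (trans (cong (r +_) (+-comm m 1)) (+-suc r m)))) ⟩
        r + m                     ≡⟨ trans (+-comm r m) k≡ ⟩
        k                         ∎)
      where
      open ≤-Reasoning
    collect : ∀ v → load h z Ed v + load r y Nd v ≡ load (r + h) y (cat r Nd Ed) v
    collect v = sym (trans (load-cat r h y Nd Ed v) (trans (+-comm (load r y Nd v) _)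
      (cong (_+ load r y Nd v) (∑-cong h λ i _ → cong (λ l → Ed i * x l v) (shift i)))))
    regroup : ∀ v → load (k + h) x D v ≡ (load m x D v + load h z (D ∘ (k +_)) v) + load r y Nd v
    regroup v = trans (load-split k h x D v) (trans (cong (_+ load h z (D ∘ (k +_)) v) (∑k (λ i → D i * x i v)))
      (lem (load m x D v) (load r y Nd v) (load h z (D ∘ (k +_)) v)))
      where
      lem : ∀ a b c → a + b + c ≡ a + c + b
      lem = solve-∀
    size≡ : 2 + (k * 1 + m') ≡ k + h
    size≡ = lem k m'
      where
      lem : ∀ k m → 2 + (k * 1 + m) ≡ k + (suc m + 1)
      lem = solve-∀
    -- Demands on the first `m`, the middle `r` and the last `h` positions, followed by the sizes of
    -- their supports; `sE` is the support size after folding.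
    F S I : ℕ
    F = ∑ m D
    S = ∑ r Nd
    I = ∑ h (D ∘ (k +_))
    sF sS sI sE : ℕ
    sF = ∑ m (ind ∘ D)
    sS = ∑ r (ind ∘ Nd)
    sI = ∑ h (ind ∘ D ∘ (k +_))
    sE = ∑ h (ind ∘ E)
    t≡ : ∑ (k + h) D ≡ F + S + I
    t≡ = trans (∑-split k h D) (cong (_+ I) (∑k D))
    s≡ : ∑ (k + h) (ind ∘ D) ≡ sF + sS + sI
    s≡ = trans (∑-split k h (ind ∘ D)) (cong (_+ sI) (∑k (ind ∘ D)))
    c≡ : ∑ (k + h) C ≡ ∑ h C'
    c≡ = trans (∑-split k h C) (cong (_+ ∑ h C') (∑-zero k C0))
    bound : (F + S + I) * 4 + m' < ∑ h C' + (sF + sS + sI)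
    bound = begin-strict
      (F + S + I) * 4 + m'               ≤⟨ +-monoˡ-≤ m' (l≤M (F + S + I) 1) ⟩
      M (F + S + I) 1 + m'               ≤⟨ M≤p (F + S + I) 1 m' ⟩
      p (F + S + I) (2 + (k * 1 + m'))   ≡⟨ cong₂ p (sym t≡) size≡ ⟩
      p (∑ (k + h) D) (k + h)            <⟨ lt ⟩
      ∑ (k + h) C + ∑ (k + h) (ind ∘ D)  ≡⟨ cong₂ _+_ c≡ s≡ ⟩
      ∑ h C' + (sF + sS + sI)            ∎
      where open ≤-Reasoning
    -- Of the budget 4(F + S + I), the folded demand uses all of 4F. Each unit of S or I needs only
    -- three, two for a pair and one for support, which leaves the slack `S + I`.
    cost : 2 * ∑ (r + h) (cat r Nd Ed) + ∑ h (λ i → ind (C' i ∸ E i)) ≤ ∑ h (λ i → C' i ∸ E i) + 1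
    cost = linear (S + I)
      (+-mono-≤ (+-mono-≤ bound (subst
          (λ e → 2 * ∑ h Ed + ∑ h (λ i → ind (C' i ∸ E i)) + (∑ h C' + sE) ≤ ∑ h (λ i → C' i ∸ E i) + (2 * e + h))
              (∑-fold m 1 k D) (∑-match-cost h C' E)))
        (+-mono-≤ (∑-ind-fold m 1 k D) (∑-mono r {ind ∘ Nd} {Nd} λ i _ → ind≤ (Nd i))))
      (trans (cong (λ e → 2 * e + ∑ h (λ i → ind (C' i ∸ E i)) +
          ((∑ h C' + (sF + sS + sI)) + (∑ h (λ i → C' i ∸ E i) + (2 * (I + 2 * F) + h)) + ((sE + I) + S)) + (S + I))
          (∑-cat r h Nd Ed (λ c _ → c)))
        (lem S I F m' (∑ h Ed) (∑ h (λ i → ind (C' i ∸ E i))) (∑ h C') sF sS sI sE (∑ h (λ i → C' i ∸ E i))))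
      where
      lem : ∀ S I F m e q c sF sS sI sE f →
        2 * (S + e) + q + ((c + (sF + sS + sI)) + (f + (2 * (I + 2 * F) + (suc m + 1))) + ((sE + I) + S)) + (S + I)
        ≡ f + 1 + ((suc ((F + S + I) * 4 + m) + (2 * e + q + (c + sE))) + ((sF + sI) + sS))
      lem = solve-∀

  -- A pebble on a neighbour a of vertex 0 already pays half of one unit of demand on 0.
  shift-demand : ∀ {n a x C D} → suc a < n → suc a ≤ k → Tok n x → 1 ≤ C (suc a) → 1 ≤ D 0 →
    load n x (drop 1 (suc a) C) ⟹ load n x (λ i → drop 1 0 D i + δ (suc a) i) → load n x C ⟹ load n x D
  shift-demand {n} {a} {x} {C} {D} a<n a≤k tok 1≤C 1≤D conv =
    ⟹-trans (≼⇒⟹ λ v → ≤-reflexive (sym (load-drop n x C v a<n 1≤C)))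
    (⟹-trans (⟹-⊕ˡ (1 · x (suc a)) conv)
    (⟹-trans (≼⇒⟹ λ v → ≤-reflexive (pair v))
    (⟹-trans (⟹-⊕ {C = load n x (drop 1 0 D)} (≼⇒⟹ λ v → ≤-refl) (tok {suc a} {0} a<n 0<n (λ ()) a≤k))
    (≼⇒⟹ λ v → ≤-reflexive (trans (load-drop n x D v 0<n 1≤D) (cong (load n x (drop 1 0 D) v +_) (*-identityˡ (x 0 v))))))))
    where
    0<n : 0 < n
    0<n = ≤-<-trans z≤n a<n
    lem : ∀ l a → l + 2 * a ≡ l + a + 1 * a
    lem = solve-∀
    pair : ∀ v → load n x (drop 1 0 D) v + 2 * x (suc a) v ≡ load n x (λ i → drop 1 0 D i + δ (suc a) i) v + 1 * x (suc a) v
    pair v = trans (lem (load n x (drop 1 0 D) v) (x (suc a) v)) (cong (_+ 1 * x (suc a) v)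
      (sym (trans (load-+ n x (drop 1 0 D) (δ (suc a)) v) (cong (load n x (drop 1 0 D) v +_) (load-δ n x v a<n)))))

  end-pebbled : ∀ {m a x C D} → k ≤ m → Below (2 + m + ∑ (2 + m) C) → Tok (2 + m) x → a < k →
    1 ≤ C (suc a) → C 0 ≡ 0 → D (suc a) ≡ 0 → 1 ≤ D 0 →
    p (∑ (2 + m) D) (2 + m) < ∑ (2 + m) C + ∑ (2 + m) (ind ∘ D) →
    load (2 + m) x C ⟹ load (2 + m) x D
  end-pebbled {m} {a} {x} {C} {D} k≤m ih tok a<k 1≤C C0 Da 1≤D lt =
    shift-demand {x = x} {C} {D} a<n a<k tok 1≤C 1≤D (conv (D 0) refl)
    where
    a<n : suc a < 2 + m
    a<n = s≤s (≤-trans a<k (m≤n⇒m≤1+n k≤m))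
    C' D' : ℕ → ℕ
    C' = drop 1 (suc a) C
    D' i = drop 1 0 D i + δ (suc a) i
    ∑C : ∑ (2 + m) C ≡ suc (∑ (2 + m) C')
    ∑C = trans (∑-drop (2 + m) C a<n 1≤C) (+-comm _ 1)
    ∑D : ∑ (2 + m) D' ≡ ∑ (2 + m) D
    ∑D = trans (∑-+ (2 + m) (drop 1 0 D) (δ (suc a))) (trans (cong (∑ (2 + m) (drop 1 0 D) +_) (∑-δ-1 (2 + m) a<n))
      (sym (∑-drop (2 + m) D (s≤s z≤n) 1≤D)))
    s s' : ℕ
    s = ∑ (1 + m) (ind ∘ D ∘ suc)
    s' = ∑ (1 + m) (ind ∘ D' ∘ suc)
    s<s' : s + 1 ≤ s'
    s<s' = begin
      s + 1                                              ≡⟨ cong (s +_) (∑-δ-1 (1 + m) (s≤s⁻¹ a<n)) ⟨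
      s + ∑ (1 + m) (δ a)                                ≡⟨ ∑-+ (1 + m) (ind ∘ D ∘ suc) (δ a) ⟨
      ∑ (1 + m) (λ i → ind (D (suc i)) + δ a i)          ≤⟨ ∑-mono (1 + m) (λ i _ → ind-δ {D ∘ suc} {a} Da i) ⟩
      s'                                                 ∎
      where open ≤-Reasoning
    conv : ∀ d → D 0 ≡ d → load (2 + m) x C' ⟹ load (2 + m) x D'
    conv zero          eq = contradiction (≤-trans 1≤D (≤-reflexive eq)) λ ()
    -- Vertex 0 loses its last unit of demand and is deleted. The support does not shrink, and
    -- `p-delete` pays for the pebble spent.
    conv (suc zero)    eq = ⟹-trans (≼⇒⟹ λ v → m≤n+m _ (C 0 * x 0 v))
      (⟹-trans (ih (1 + m) (x ∘ suc) (C' ∘ suc) (D' ∘ suc) small (Tok-suffix 1 (1 + m) x tok) (inj₂ good))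
      (≼⇒⟹ λ v → ≤-reflexive (cong (λ d → (d ∸ 1 + 0) * x 0 v + load (1 + m) (x ∘ suc) (D' ∘ suc) v) eq)))
      where
      ∑C' : ∑ (1 + m) (C' ∘ suc) ≡ ∑ (2 + m) C'
      ∑C' = cong (_+ ∑ (1 + m) (C' ∘ suc)) (sym C0)
      small : 1 + m + ∑ (1 + m) (C' ∘ suc) < 2 + m + ∑ (2 + m) C
      small = s≤s (+-monoʳ-≤ (1 + m) (≤-trans (≤-reflexive ∑C') (≤-trans (n≤1+n _) (≤-reflexive (sym ∑C)))))
      ∑D' : ∑ (1 + m) (D' ∘ suc) ≡ ∑ (2 + m) D
      ∑D' = trans (cong (λ d → d ∸ 1 + 0 + ∑ (1 + m) (D' ∘ suc)) (sym eq)) ∑D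
      less : p (∑ (2 + m) D) (1 + m) < p (∑ (2 + m) D) (2 + m)
      less = subst (λ m' → p (∑ (2 + m) D) (1 + m') < p (∑ (2 + m) D) (2 + m')) (m+[n∸m]≡n (≤-trans 1≤k k≤m))
        (p-delete (∑ (2 + m) D) (m ∸ 1))
      lem : ∀ q p c s s' → suc q + (p + (suc c + (1 + s)) + s') + 0 ≡ c + s' + (suc q + suc p + (s + 1))
      lem = solve-∀
      good : p (∑ (1 + m) (D' ∘ suc)) (1 + m) < ∑ (1 + m) (C' ∘ suc) + s'
      good = subst (_< ∑ (1 + m) (C' ∘ suc) + s') (cong (λ t → p t (1 + m)) (sym ∑D'))
        (linear 0 (+-mono-≤ (+-mono-≤ less
            (subst (p (∑ (2 + m) D) (2 + m) <_) (cong₂ (λ c d → c + (ind d + s)) (trans ∑C (cong suc (sym ∑C'))) eq) lt)) s<s')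
          (lem (p (∑ (2 + m) D) (1 + m)) (p (∑ (2 + m) D) (2 + m)) (∑ (1 + m) (C' ∘ suc)) s s'))
    -- Vertex 0 stays demanded, so the new support point `suc a` makes up for the pebble spent.
    conv (suc (suc d)) eq = ih (2 + m) x C' D' (+-monoʳ-< (2 + m) (≤-reflexive (sym ∑C))) tok (inj₂ good)
      where
      s'≡ : ∑ (2 + m) (ind ∘ D') ≡ 1 + s'
      s'≡ = cong (λ d → ind (d ∸ 1 + 0) + s') eq
      lem : ∀ p c s s' → suc p + ((suc c + (1 + s)) + s') + 0 ≡ c + (1 + s') + (suc p + (s + 1))
      lem = solve-∀
      good : p (∑ (2 + m) D') (2 + m) < ∑ (2 + m) C' + ∑ (2 + m) (ind ∘ D')
      good = subst (λ t → p t (2 + m) < ∑ (2 + m) C' + ∑ (2 + m) (ind ∘ D')) (sym ∑D)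
          (subst (λ u → p (∑ (2 + m) D) (2 + m) < ∑ (2 + m) C' + u) (sym s'≡)
        (linear 0 (+-mono-≤ (subst (p (∑ (2 + m) D) (2 + m) <_) (cong₂ (λ c d → c + (ind d + s)) ∑C eq) lt) s<s')
          (lem (p (∑ (2 + m) D) (2 + m)) (∑ (2 + m) C') s s')))

  end-empty : ∀ {m x C D} → k ≤ m → Below (2 + m + ∑ (2 + m) C) → Tok (2 + m) x → (∀ i → i < k → C i ≡ 0) →
    p (∑ (2 + m) D) (2 + m) < ∑ (2 + m) C + ∑ (2 + m) (ind ∘ D) → load (2 + m) x C ⟹ load (2 + m) x D
  end-empty {m} {x} {C} {D} k≤m ih tok empty lt with k + k ≤? m
  ... | yes 2k≤m = far {q = m ∸ (k + k)} {x} {C} {D}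
      (trans (cong (2 +_) (sym (m+[n∸m]≡n 2k≤m))) (lem k (m ∸ (k + k)))) ih tok empty lt
    where
    lem : ∀ k q → 2 + (k + k + q) ≡ k + (k + (2 + q))
    lem = solve-∀
  -- The path has m + 2 vertices, so n - k - 1 is `suc (m ∸ k)`, and 2k - 1 - m positions lie
  -- between the folded ones and position k.
  ... | no  2k≰m = near {m = m ∸ k} {k + k ∸ suc m} {x} {C} {D}
      (trans (cong (2 +_) (sym (m+[n∸m]≡n k≤m))) (lem k (m ∸ k)))
      (+-cancelˡ-≡ k _ _ (trans (trans (lem' k (m ∸ k) (k + k ∸ suc m)) (cong (λ q → suc q + (k + k ∸ suc m)) (m+[n∸m]≡n k≤m)))
          (m+[n∸m]≡n (≰⇒> 2k≰m))))
      tok empty lt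
    where
    lem : ∀ k q → 2 + (k + q) ≡ k + (suc q + 1)
    lem = solve-∀
    lem' : ∀ k q r → k + (suc q + r) ≡ suc (k + q) + r
    lem' = solve-∀

  end : ∀ {m x C D} → k ≤ m → Below (2 + m + ∑ (2 + m) C) → Tok (2 + m) x → Disjoint (2 + m) C D → 1 ≤ D 0 →
    p (∑ (2 + m) D) (2 + m) < ∑ (2 + m) C + ∑ (2 + m) (ind ∘ D) → load (2 + m) x C ⟹ load (2 + m) x D
  end {m} {x} {C} {D} k≤m ih tok disj 1≤D lt with disj 0 (s≤s z≤n)
  ... | inj₂ D0 = contradiction (≤-trans 1≤D (≤-reflexive D0)) λ ()
  ... | inj₁ C0 with anyUpTo? (λ i → 1 ≤? C (suc i)) k
  ...   | yes (a , a<k , 1≤C) with disj (suc a) (s≤s (≤-trans a<k (m≤n⇒m≤1+n k≤m)))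
  ...     | inj₁ Ca = contradiction (≤-trans 1≤C (≤-reflexive Ca)) λ ()
  ...     | inj₂ Da = end-pebbled {x = x} {C} {D} k≤m ih tok a<k 1≤C C0 Da 1≤D lt
  end {m} {x} {C} {D} k≤m ih tok disj 1≤D lt | inj₁ C0 | no none = end-empty {m} {x} {C} {D} k≤m ih tok empty lt
    where
    empty : ∀ i → i < k → C i ≡ 0
    empty zero    _   = C0
    empty (suc i) i<k = n<1⇒n≡0 (≰⇒> λ 1≤C → none (i , <-trans (n<1+n i) i<k , 1≤C))

  -- Cutting the path when no end is demanded.

  bad : ∀ {n C D} → ¬ Good n C D → ∃ (λ t → ∑ n D ≡ suc t) × ∑ n C + ∑ n (ind ∘ D) ≤ p (∑ n D) n
  bad {n} {C} {D} ¬g with ∑ n D in eq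
  ... | zero  = contradiction (inj₁ refl) ¬g
  ... | suc t = (t , refl) , ≮⇒≥ (¬g ∘ inj₂)

  -- A failing side has positive demand, so `p-superadd` applies; its index is one less than the
  -- combined demand.
  clash : ∀ {n₁ n₂ n} m r {C₁ D₁ C₂ D₂} → n₁ ≡ 2 + m → n₂ ≡ 2 + r → n ≡ 2 + (m + suc r) →
    ¬ Good n₁ C₁ D₁ → ¬ Good n₂ C₂ D₂ →
    ∃ λ t → ∑ n₁ D₁ + ∑ n₂ D₂ ≡ suc t ×
      (∑ n₁ C₁ + ∑ n₁ (ind ∘ D₁)) + (∑ n₂ C₂ + ∑ n₂ (ind ∘ D₂)) ≤ p t n + 1
  clash m r {C₁} {D₁} {C₂} {D₂} refl refl refl ¬g₁ ¬g₂ with bad {2 + m} {C₁} {D₁} ¬g₁ | bad {2 + r} {C₂} {D₂} ¬g₂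
  ... | (α , eq₁) , le₁ | (β , eq₂) , le₂ =
    suc (α + β) , trans (cong₂ _+_ eq₁ eq₂) (cong suc (+-suc α β)) ,
    ≤-trans (+-mono-≤ le₁ le₂) (≤-trans (≤-reflexive (cong₂ (λ a b → p a (2 + m) + p b (2 + r)) eq₁ eq₂)) (p-superadd α β m r))

  join : ∀ m r x C D → load m x C ⟹ load m x D →
    load r (x ∘ (m +_)) (C ∘ (m +_)) ⟹ load r (x ∘ (m +_)) (D ∘ (m +_)) → load (m + r) x C ⟹ load (m + r) x D
  join m r x C D l⟹ r⟹ = ⟹-trans (≼⇒⟹ λ v → ≤-reflexive (sym (load-split m r x C v)))
    (⟹-trans (⟹-⊕ l⟹ r⟹) (≼⇒⟹ λ v → ≤-reflexive (load-split m r x D v)))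

  -- The cut vertex belongs to both sides. Being free of pebbles, it may be counted twice in `C`,
  -- while its demand is divided as `a + c`.
  joinAt : ∀ m r a c x C D → C (m + 0) ≡ 0 → a + c ≡ D (m + 0) →
    load (m + 1) x C ⟹ load (m + 1) x (cat m D (λ _ → a)) →
    load (1 + r) (x ∘ (m +_)) (C ∘ (m +_)) ⟹ load (1 + r) (x ∘ (m +_)) (cat 1 (λ _ → c) (λ i → D (m + suc i))) →
    load (m + (1 + r)) x C ⟹ load (m + (1 + r)) x D
  joinAt m r a c x C D C≡0 a+c l⟹ r⟹ =
    ⟹-trans (≼⇒⟹ λ v → ≤-reflexive
        (trans (cong₂ _+_ (trans (load-split m 1 x C v)
            (trans (cong (λ q → load m x C v + (q * x (m + 0) v + 0)) C≡0) (+-identityʳ (load m x C v))))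
                (refl {x = load (1 + r) (x ∘ (m +_)) (C ∘ (m +_)) v})) (sym (load-split m (1 + r) x C v))))
    (⟹-trans (⟹-⊕ l⟹ r⟹)
    (≼⇒⟹ λ v → ≤-reflexive (begin
      load (m + (1 + r)) x D v
        ≡⟨ load-split m (1 + r) x D v ⟩
      load m x D v + (D (m + 0) * x (m + 0) v + rest v)
        ≡⟨ cong (λ d → load m x D v + (d * x (m + 0) v + rest v)) a+c ⟨
      load m x D v + ((a + c) * x (m + 0) v + rest v)
        ≡⟨ lem (load m x D v) a c (x (m + 0) v) (rest v) ⟩
      load m x D v + (a * x (m + 0) v + 0) + (c * x (m + 0) v + rest v)
        ≡⟨ cong (_+ (c * x (m + 0) v + rest v)) (load-cat m 1 x D (λ _ → a) v) ⟨
      load (m + 1) x (cat m D (λ _ → a)) v + (c * x (m + 0) v + rest v) ∎)))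
    where
    open ≡-Reasoning
    rest : Config N
    rest v = ∑ r (λ i → D (m + suc i) * x (m + suc i) v)
    lem : ∀ l a c x r → l + ((a + c) * x + r) ≡ l + (a * x + 0) + (c * x + r)
    lem = solve-∀

  module Cut {n x C D} (ih : Below (n + ∑ n C)) (tok : Tok n x) (disj : Disjoint n C D)
    (lt : p (∑ n D) n < ∑ n C + ∑ n (ind ∘ D)) (last≡0 : ∀ i → suc i ≡ n → D i ≡ 0) where

    Result : Set
    Result = load n x C ⟹ load n x D

    prefix : ∀ m r D' → m + suc r ≡ n → Good m C D' → load m x C ⟹ load m x D'
    prefix m r D' refl = ih m x C D'
      (+-mono-<-≤ (m<m+n m (s≤s z≤n))
          (≤-trans (m≤m+n (∑ m C) (∑ (suc r) (C ∘ (m +_)))) (≤-reflexive (sym (∑-split m (suc r) C)))))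
      (Tok-prefix (m≤m+n m (suc r)) tok)

    suffix : ∀ m r D' → suc m + r ≡ n → Good r (C ∘ (suc m +_)) D' →
      load r (x ∘ (suc m +_)) (C ∘ (suc m +_)) ⟹ load r (x ∘ (suc m +_)) D'
    suffix m r D' refl = ih r (x ∘ (suc m +_)) (C ∘ (suc m +_)) D'
      (+-mono-<-≤ (m<n+m r {suc m} (s≤s z≤n)) (≤-trans (m≤n+m _ (∑ (suc m) C)) (≤-reflexive (sym (∑-split (suc m) r C)))))
      (Tok-suffix (suc m) r x tok)

    left right : ℕ → ℕ → ℕ → ℕ
    left  m a = cat m D (λ _ → a)
    right m c = cat 1 (λ _ → c) (λ i → D (m + suc i))

    ∑-left : ∀ m a (h : ℕ → ℕ) → ∑ (m + 1) (h ∘ left m a) ≡ ∑ m (h ∘ D) + (h a + 0)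
    ∑-left m a h = ∑-cat m 1 D (λ _ → a) (λ c _ → h c)

    Left : ℕ → ℕ → Set
    Left m a = Good (m + 1) C (left m a)

    good-left : ∀ m → Left m (D (m + 0)) → Good (m + 1) C D
    good-left m = subst (λ t → t ≡ 0 ⊎ p t (m + 1) < ∑ (m + 1) C + ∑ (m + 1) (ind ∘ D)) (same (λ d → d))
      ∘ subst (λ s → ∑ (m + 1) (left m (D (m + 0))) ≡ 0 ⊎ p (∑ (m + 1) (left m (D (m + 0)))) (m + 1) < ∑ (m + 1) C + s) (same ind)
      where
      same : ∀ (h : ℕ → ℕ) → ∑ (m + 1) (h ∘ left m (D (m + 0))) ≡ ∑ (m + 1) (h ∘ D)
      same h = trans (∑-left m (D (m + 0)) h) (sym (∑-split m 1 (h ∘ D)))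

    module _ (m r : ℕ) (eq : suc m + suc (suc r) ≡ n) where

      q e CA CB A B AI BI : ℕ
      q  = suc m
      e  = D (q + 0)
      CA = ∑ q C
      CB = ∑ (suc r) (λ i → C (q + suc i))
      A  = ∑ q D
      B  = ∑ (suc r) (λ i → D (q + suc i))
      AI = ∑ q (ind ∘ D)
      BI = ∑ (suc r) (λ i → ind (D (q + suc i)))

      ∑n : ∀ f → ∑ n f ≡ ∑ q f + (f (q + 0) + ∑ (suc r) (λ i → f (q + suc i)))
      ∑n f = trans (cong (λ n → ∑ n f) (sym eq)) (∑-split q (suc (suc r)) f)

      n≡ : n ≡ 2 + (m + suc r)
      n≡ = trans (sym eq) (cong suc (+-suc m (suc r)))

      both-fail : ∀ D₂ a → ¬ Left q a → ¬ Good (2 + r) (C ∘ (q +_)) D₂ →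
        ∃ λ t → A + a + ∑ (2 + r) D₂ ≡ suc t × ∑ n C + (AI + ind a + ∑ (2 + r) (ind ∘ D₂)) ≤ p t n + 1
      both-fail D₂ a ¬l ¬r with clash {q + 1} {2 + r} m r {C} {left q a} {C ∘ (q +_)} {D₂} (cong suc (+-comm m 1)) refl n≡ ¬l ¬r
      ... | t , t≡ , le = t ,
        trans (cong (_+ ∑ (2 + r) D₂) (trans (cong (A +_) (sym (+-identityʳ a))) (sym (∑-left q a (λ c → c))))) t≡ ,
        -- Pebbles on the cut vertex are counted on both sides, hence the slack `C (q + 0)`.
        ≤-trans (linear {a = 0} {b = 0} (C (q + 0)) z≤n (trans
            (cong (λ c → c + (AI + ind a + R) + 0 + C (q + 0)) (∑n C))
            (trans (lem CA (C (q + 0)) CB AI (ind a) R)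
                (cong₂ (λ c i → c + i + ((C (q + 0) + CB) + R) + 0) (sym (∑-split q 1 C)) (sym (∑-left q a ind))))))
          le
        where
        R = ∑ (2 + r) (ind ∘ D₂)
        lem : ∀ CA x CB AI i R → CA + (x + CB) + (AI + i + R) + 0 + x ≡ CA + (x + 0) + (AI + (i + 0)) + (x + CB + R) + 0
        lem = solve-∀

      -- All demand of the cut vertex lies on the right, so two failures give t = |D| - 1. By
      -- `p-suc`, p_t(n) + 1 is below the bound for |D|, against `lt`.
      cut-good : ¬ Good (2 + r) (C ∘ (q +_)) (D ∘ (q +_)) → Left q 0
      cut-good ¬r with good? (q + 1) C (left q 0)
      ... | yes g = g
      ... | no ¬l with both-fail (D ∘ (q +_)) 0 ¬l ¬r
      ...   | t , t≡ , le = contradiction lt (≤⇒≯ (linear 1 (+-mono-≤ le less)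
        (trans (cong (λ s → ∑ n C + s + ((p t n + 1) + p (∑ n D) n) + 1) (trans (∑n (ind ∘ D)) (lem₁ AI (ind e) BI)))
          (lem (∑ n C) (AI + 0 + (ind e + BI)) (p t n) (p (∑ n D) n)))))
        where
        lem₁ : ∀ a b c → a + (b + c) ≡ a + 0 + (b + c)
        lem₁ = solve-∀
        lem : ∀ c s u v → c + s + ((u + 1) + v) + 1 ≡ v + (c + s + (u + 2))
        lem = solve-∀
        less : p t n + 2 ≤ p (∑ n D) n
        less = subst (λ n' → p t n' + 2 ≤ p (∑ n D) n') (sym n≡) (subst (λ u → p t (2 + (m + suc r)) + 2 ≤ p u (2 + (m + suc r)))
          (sym (trans (∑n D) (trans (lem₁ A e B) t≡))) (p-suc t (m + suc r)))

      -- The shares `suc a` and `e ∸ a` exceed `e` by one, so two failures give t = |D|. The extra 1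
      -- in the bound is offset because the cut vertex lies in both supports.
      split-good : ∀ a → a < e → ¬ Left q (suc a) → Good (2 + r) (C ∘ (q +_)) (right q (e ∸ a))
      split-good a a<e ¬l with good? (2 + r) (C ∘ (q +_)) (right q (e ∸ a))
      ... | yes g = g
      ... | no ¬r with both-fail (right q (e ∸ a)) (suc a) ¬l ¬r
      ...   | t , t≡ , le = contradiction lt (≤⇒≯ (≤-trans (+-monoʳ-≤ (∑ n C) s≤) (linear 0 le (trans (lem (∑ n C) AI BI (p t n))
              (cong₂ (λ c u → c + (∑ n C + (AI + 1 + (u + BI)))) (cong (λ u → p u n) (sym t'≡)) (sym i≡))))))
        where
        i≡ : ind (e ∸ a) ≡ 1
        i≡ = ≤-antisym (ind≤1 _) (1≤ind (m<n⇒0<n∸m a<e))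
        s≤ : ∑ n (ind ∘ D) ≤ AI + (1 + BI)
        s≤ = ≤-trans (≤-reflexive (∑n (ind ∘ D))) (+-monoʳ-≤ AI (+-monoˡ-≤ BI (ind≤1 e)))
        lem₁ : ∀ A a c B → A + suc a + (c + B) ≡ suc (A + ((a + c) + B))
        lem₁ = solve-∀
        t'≡ : ∑ n D ≡ t
        t'≡ = trans (∑n D) (trans (cong (λ c → A + (c + B)) (sym (m+[n∸m]≡n (<⇒≤ a<e))))
            (suc-injective (trans (sym (lem₁ A a (e ∸ a) B)) t≡)))
        lem : ∀ c a b u → c + (a + (1 + b)) + (u + 1) + 0 ≡ u + (c + (a + 1 + (1 + b)))
        lem = solve-∀

    -- Invariant: the first `suc m` vertices are `Good` by themselves. The cut moves to the right
    -- until the rest is `Good` too or the next vertex breaks the left side.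
    go : ∀ r m → suc m + suc r ≡ n → Good (suc m) C D → Result
    go r m eq g with good? (suc r) (C ∘ (suc m +_)) (D ∘ (suc m +_))
    go r m refl g | yes gʳ = join (suc m) (suc r) x C D (prefix (suc m) r D refl g) (suffix m (suc r) (D ∘ (suc m +_)) refl gʳ)
    -- The right side has shrunk to the last vertex, which is undemanded and hence `Good`.
    go zero m eq g | no ¬gʳ = contradiction
        (inj₁ (trans (+-identityʳ _) (last≡0 (suc m + 0) (trans (sym (+-suc (suc m) 0)) eq)))) ¬gʳ
    go (suc r) m eq g | no ¬gʳ with good? (suc m + 1) C (left (suc m) (D (suc m + 0)))
    ... | yes gˡ = go r (m + 1) (trans (cong suc (+-assoc m 1 (suc r))) eq) (good-left (suc m) gˡ)
    -- With no share of the next vertex's demand the left side is `Good`, with all of it it is not.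
    -- The switch `a` is the share it receives.
    ... | no ¬gˡ with first-failure (λ a → good? (suc m + 1) C (left (suc m) a)) (D (suc m + 0)) (cut-good m r eq ¬gʳ) ¬gˡ
    ...   | a , a<e , gˡ , ¬gˡ⁺ with disj (suc m + 0) (≤-trans (+-monoʳ-< (suc m) (s≤s z≤n)) (≤-reflexive eq))
    ...     | inj₂ D≡0 = contradiction (≤-trans a<e (≤-reflexive D≡0)) λ ()
    ...     | inj₁ C≡0 = finish eq
      where
      finish : suc m + suc (suc r) ≡ n → Result
      finish refl = joinAt (suc m) (suc r) a (D (suc m + 0) ∸ a) x C D C≡0 (m+[n∸m]≡n (<⇒≤ a<e))
        (prefix (suc m + 1) r (left (suc m) a) (+-assoc (suc m) 1 (suc r)) gˡ)
        (suffix m (suc (suc r)) (right (suc m) (D (suc m + 0) ∸ a)) refl (split-good m r eq a a<e ¬gˡ⁺))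

  -- Reversal, matching and the induction.

  load-reverse : ∀ n x C v → load n (λ i → x (n ∸ suc i)) (λ i → C (n ∸ suc i)) v ≡ load n x C v
  load-reverse n x C v = ∑-reverse n (λ i → C i * x i v)

  disjoint-case : ∀ {m x C D} → k ≤ m → Below (2 + m + ∑ (2 + m) C) → Tok (2 + m) x → Disjoint (2 + m) C D →
    p (∑ (2 + m) D) (2 + m) < ∑ (2 + m) C + ∑ (2 + m) (ind ∘ D) → load (2 + m) x C ⟹ load (2 + m) x D
  disjoint-case {m} {x} {C} {D} k≤m ih tok disj lt with D 0 ≟ 0 | D (1 + m) ≟ 0
  ... | no  D0 | _      = end {m} {x} {C} {D} k≤m ih tok disj (n≢0⇒n>0 D0) lt
  ... | yes D0 | no  Dn =
    ⟹-trans (≼⇒⟹ λ v → ≤-reflexive (load-reverse n x C v))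
    (⟹-trans (end {m} {λ i → x (n ∸ suc i)} {C'} {D'} k≤m
      (subst (λ c → Below (n + c)) (sym (∑-reverse n C)) ih) (Tok-reverse {n} {x} tok)
      (λ i i<n → disj (n ∸ suc i) (n∸[1+i]<n i<n)) (n≢0⇒n>0 Dn) lt')
    (≼⇒⟹ λ v → ≤-reflexive (sym (load-reverse n x D v))))
    where
    n = 2 + m
    C' D' : ℕ → ℕ
    C' i = C (n ∸ suc i)
    D' i = D (n ∸ suc i)
    lt' : p (∑ n D') n < ∑ n C' + ∑ n (ind ∘ D')
    lt' = subst (λ t → p t n < ∑ n C' + ∑ n (ind ∘ D')) (sym (∑-reverse n D))
      (subst (p (∑ n D) n <_) (sym (cong₂ _+_ (∑-reverse n C) (∑-reverse n (ind ∘ D)))) lt)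
  -- The scan starts from vertex 0 alone, whose demand is zero.
  ... | yes D0 | yes Dn = Cut.go {2 + m} {x} {C} {D} ih tok disj lt (λ { _ refl → Dn }) m 0 refl (inj₁ (trans (+-identityʳ _) D0))

  -- Matching u pebbles lowers |C| by u and s(D) by at most u, while by `p-+` the bound falls by at
  -- least 2u.
  Good-match : ∀ m C D → p (∑ (2 + m) D) (2 + m) < ∑ (2 + m) C + ∑ (2 + m) (ind ∘ D) →
    p (∑ (2 + m) (λ i → D i ∸ C i)) (2 + m) < ∑ (2 + m) (λ i → C i ∸ D i) + ∑ (2 + m) (λ i → ind (D i ∸ C i))
  Good-match m C D lt = linear 0
    (+-mono-≤ (+-mono-≤ (subst (λ t → p (∑ n D∸C) n + 2 * ∑ n C⊓D ≤ p t n) (sym D≡) (p-+ (∑ n D∸C) (∑ n C⊓D) m))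
        (subst (λ c → p (∑ n D) n < c + ∑ n (ind ∘ D)) C≡ lt)) s≤)
    (lem (p (∑ n D∸C) n) (∑ n C⊓D) (p (∑ n D) n) (∑ n C∸D) (∑ n (ind ∘ D)) (∑ n (ind ∘ D∸C)))
    where
    n = 2 + m
    D∸C C∸D C⊓D : ℕ → ℕ
    D∸C i = D i ∸ C i
    C∸D i = C i ∸ D i
    C⊓D i = C i ⊓ D i
    D≡ : ∑ n D ≡ ∑ n D∸C + ∑ n C⊓D
    D≡ = trans (∑-cong n λ i _ → trans (sym (m⊓n+n∸m≡n (C i) (D i))) (+-comm (C⊓D i) _)) (∑-+ n D∸C C⊓D)
    C≡ : ∑ n C ≡ ∑ n C∸D + ∑ n C⊓D
    C≡ = trans (∑-cong n λ i _ → trans (sym (m⊓n+n∸m≡n (D i) (C i)))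
        (trans (+-comm (D i ⊓ C i) _) (cong (C∸D i +_) (⊓-comm (D i) (C i))))) (∑-+ n C∸D C⊓D)
    ind-match : ∀ c d → ind d ≤ ind (d ∸ c) + c ⊓ d
    ind-match c       zero    = z≤n
    ind-match zero    (suc d) = s≤s z≤n
    ind-match (suc c) (suc d) = ≤-trans (s≤s z≤n) (m≤n+m (suc (c ⊓ d)) _)
    s≤ : ∑ n (ind ∘ D) ≤ ∑ n (ind ∘ D∸C) + ∑ n C⊓D
    s≤ = ≤-trans (∑-mono n λ i _ → ind-match (C i) (D i)) (≤-reflexive (∑-+ n (ind ∘ D∸C) C⊓D))
    lem : ∀ p' u p c s s' → suc p' + (p + (c + u + s) + (s' + u)) + 0 ≡ c + s' + (p' + 2 * u + suc p + s)
    lem = solve-∀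

  ∸-disjoint : ∀ c d → c ∸ d ≡ 0 ⊎ d ∸ c ≡ 0
  ∸-disjoint c d = [ inj₁ ∘ m≤n⇒m∸n≡0 , inj₂ ∘ m≤n⇒m∸n≡0 ]′ (≤-total c d)

  solvable : ∀ s → Below s
  solvable (suc s) n x C D _ tok (inj₁ D≡0) = ≼⇒⟹ λ v → ≤-trans (≤-reflexive (load-zero n x D≡0 v)) z≤n
  solvable (suc s) n x C D (s≤s n≤s) tok (inj₂ lt) with n ≤? suc k
  ... | yes n≤ = clique {n} {x} {C} {D} n≤ tok lt
  ... | no  n≰ with n | ≰⇒> n≰
  ...   | suc (suc m) | s≤s (s≤s k≤m) = match (2 + m) x C D
      (disjoint-case k≤m ih tok (λ i _ → ∸-disjoint (C i) (D i)) (Good-match m C D lt))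
    where
    ih : Below (2 + m + ∑ (2 + m) (λ i → C i ∸ D i))
    ih n' x' C' D' n'<n = solvable s n' x' C' D'
      (<-≤-trans n'<n (≤-trans (+-monoʳ-≤ (2 + m) (∑-mono (2 + m) λ i _ → m∸n≤m (C i) (D i))) n≤s))

  -- From tokens to the vertices of the graph.

  vertex : ℕ → Config N
  vertex i v = δ i (toℕ v)

  Tok-vertex : Tok N vertex
  Tok-vertex {i} {j} i<N j<N i≢j d = _ , step u w adj 2≤ ◅ ε , ends
    where
    u = fromℕ< i<N
    w = fromℕ< j<N
    u≡ : toℕ u ≡ i
    u≡ = toℕ-fromℕ< i<N
    w≡ : toℕ w ≡ j
    w≡ = toℕ-fromℕ< j<N
    dist : ∣ toℕ u - toℕ w ∣ ≡ ∣ i - j ∣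
    dist = cong₂ ∣_-_∣ u≡ w≡
    adj : Adj N k u w
    adj = subst (1 ≤_) (sym dist) (n≢0⇒n>0 (i≢j ∘ ∣m-n∣≡0⇒m≡n)) , subst (_≤ k) (sym dist) d
    2≤ : 2 ≤ 2 * δ i (toℕ u)
    2≤ rewrite u≡ | δ-refl i = ≤-refl
    ends : vertex j ≼ move (2 · vertex i) u w
    ends v with v Fin.≟ u | v Fin.≟ w
    ... | yes refl | _     = ≤-trans (≤-reflexive (trans (cong (δ j) u≡) (δ-≢ (i≢j ∘ sym)))) z≤n
    ... | no _     | yes refl = ≤-trans (≤-reflexive (trans (cong (δ j) w≡) (δ-refl j))) (s≤s z≤n)
    ... | no _     | no v≢w = ≤-trans (≤-reflexive (δ-≢ λ e → v≢w (toℕ-injective (trans (sym e) (sym w≡))))) z≤n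

extend : ∀ {n} → Config n → ℕ → ℕ
extend {zero}  C _       = 0
extend {suc n} C zero    = C zero
extend {suc n} C (suc i) = extend (C ∘ suc) i

extend-toℕ : ∀ {n} (C : Config n) v → extend C (toℕ v) ≡ C v
extend-toℕ C zero    = refl
extend-toℕ C (suc v) = extend-toℕ (C ∘ suc) v

∑-extend : ∀ {n} (h : ℕ → ℕ) (C : Config n) → sum (map (h ∘ C) (allFin n)) ≡ ∑ n (h ∘ extend C)
∑-extend {n} h C = trans (cong sum (map-tabulate (λ v → v) (h ∘ C))) (sum-tabulate n C)
  where
  sum-tabulate : ∀ n (C : Config n) → sum (tabulate (h ∘ C)) ≡ ∑ n (h ∘ extend C)
  sum-tabulate zero    C = refl
  sum-tabulate (suc n) C = cong (h (C zero) +_) (sum-tabulate n (C ∘ suc))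

support-ind : ∀ {n} (D : Config n) → support D ≡ sum (map (ind ∘ D) (allFin n))
support-ind {n} D = trans (proj₂ summand) (cong sum (map-cong agree (allFin n)))
  where
  summand : ∃ λ (g : Config n) → support D ≡ sum (map g (allFin n))
  -- Unification recovers the summand that is local to `support` and cannot be named here.
  summand = _ , refl
  agree : ∀ v → proj₁ summand v ≡ ind (D v)
  agree v with D v
  ... | zero  = refl
  ... | suc _ = refl

load-vertex : ∀ {n} k .{{_ : NonZero k}} (C : Config n) v → Conversion.load n k n (PathPower.vertex n k) (extend C) v ≡ C v
load-vertex {n} k C v = trans (∑-cong n λ i _ → trans (*-comm (extend C i) _) (cong (_* extend C i) (δ-sym i (toℕ v))))
  (trans (∑-δ n (extend C) (toℕ<n v)) (extend-toℕ C v))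

theorem5 : (n k t : ℕ) → 2 ≤ n → .{{_ : NonZero k}} → 1 ≤ t →
    (D : Config n) → size D ≡ t →
    (C : Config n) → pt t n k ∸ support D + 1 ≤ size C →
    Solvable n k D C
theorem5 n k t _ _ D D≡t C le =
  ⟹-trans (≼⇒⟹ λ v → ≤-reflexive (load-vertex k C v))
  (⟹-trans (solvable (suc (n + ∑ n (extend C))) n vertex (extend C) (extend D) ≤-refl Tok-vertex (inj₂ enough))
  (≼⇒⟹ λ v → ≤-reflexive (sym (load-vertex k D v))))
  where
  open Conversion n k
  open PathPower n k
  enough : pt (∑ n (extend D)) n k < ∑ n (extend C) + ∑ n (ind ∘ extend D)
  enough = begin-strict
    pt (∑ n (extend D)) n k                         ≡⟨ cong (λ s → pt s n k) (trans (sym (∑-extend (λ c → c) D)) D≡t) ⟩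
    -- This holds even where the subtraction truncates.
    pt t n k                                        ≤⟨ m≤n+m∸n (pt t n k) (support D) ⟩
    support D + (pt t n k ∸ support D)              <⟨ +-monoʳ-< (support D) (≤-trans (≤-reflexive (+-comm 1 _)) le) ⟩
    support D + size C                              ≡⟨ +-comm (support D) _ ⟩
    size C + support D                              ≡⟨ cong₂ _+_ (∑-extend (λ c → c) C) (trans (support-ind D) (∑-extend ind D)) ⟩
    ∑ n (extend C) + ∑ n (ind ∘ extend D)           ∎
    where open ≤-Reasoning
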